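{- For all integers $n \geq 1$ we have \[ |A_{2n}(2143)| = |\operatorname{SYT}(n, n, n)| = |A_{2n}(1234)| = \frac{2 \cdot (3n)!}{n!\,(n + 1)!\,(n + 2)!}. \]
   Context: A permutation $w = w_1w_2\cdots w_m$ of length $m$ is a word containing each element of $[m]=\{1,\dots,m\}$ exactly once. It is alternating if $w_1 < w_2 > w_3 < w_4 > \cdots$ (up-down convention); $A_m$ is the set of alternating permutations of length $m$. A permutation $w$ contains the pattern $p = p_1 \cdots p_k \in S_k$ if there are indices $i_1 < \cdots < i_k$ such that $w_{i_\ell} < w_{i_r}$ if and only if $p_\ell < p_r$; otherwise $w$ avoids $p$. $A_m(p)$ is the set of elements of $A_m$ that avoid $p$. $\operatorname{SYT}(n,n,n)$ is the set of standard Young tableaux of shape $\langle n,n,n\rangle$ (three rows of length $n$), i.e. fillings of the $3n$ boxes with the elements of $[3n]$, each used exactly once, with entries increasing along rows and columns. $|S|$ denotes the size of the set $S$. -}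

module Defs where

open import Data.Fin.Base using (Fin; toℕ; _<_; _>_)
open import Data.Fin.Patterns using (0F; 1F; 2F; 3F)
open import Data.Fin.Properties using (_≟_; any?; all?)
open import Data.Nat.Base using (ℕ; suc; _+_; _*_; _!; NonZero)
open import Data.Nat.Divisibility using (_∣_; _∤_)
open import Data.Nat.Properties using (m*n≢0; _!≢0)
open import Data.Irrelevant using ([_])
open import Data.Product using (_×_; _,_; ∃; ∃!)
open import Data.Refinement using (Refinement-syntax; value)
open import Data.Vec.Base using (Vec; []; _∷_; lookup)
open import Function.Bundles using (_↔_; _⇔_)
open import Relation.Binary.PropositionalEquality using (_≡_)
open import Relation.Nullary using (Dec; ¬_)
open import Relation.Nullary.Decidable using (map′; _×-dec_; _→-dec_; True; toWitness)

-- Subsets are refinement types `[ x ∈ A ∣ P x ]`: the proof of P is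
-- irrelevant, so propositional equality of elements is equality of the
-- underlying words or fillings and each of these is counted once.
HasSize : Set → ℕ → Set
HasSize S N = S ↔ Fin N

-- The letters 1, …, m of [m] are represented in order by 0, …, m - 1 : Fin m,
-- and likewise for positions in a word.
Word : ℕ → Set
Word m = Vec (Fin m) m

IsPermutation : ∀ {m} → Word m → Set
IsPermutation {m} w = ∀ (a : Fin m) → ∃! _≡_ λ (i : Fin m) → lookup w i ≡ a

Permutation : ℕ → Set
Permutation m = [ w ∈ Word m ∣ IsPermutation w ]

infixl 9 _at_
_at_ : ∀ {m} → Permutation m → Fin m → Fin m
w at i = lookup (value w) i

-- The index i stands for position i + 1, so an ascent is required
-- at the even i, starting with w₁ < w₂.
Alternating : ∀ {m} → Permutation m → Set
Alternating {m} w =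
  ∀ (i j : Fin m) → toℕ j ≡ suc (toℕ i) →
  (2 ∣ toℕ i → w at i < w at j) × (2 ∤ toℕ i → w at i > w at j)

Contains : ∀ {m k} → Permutation m → Permutation k → Set
Contains {m} {k} w p =
  ∃ λ (ι : Vec (Fin m) k) →
      (∀ (l r : Fin k) → l < r → lookup ι l < lookup ι r)
    × (∀ (l r : Fin k) → (w at lookup ι l < w at lookup ι r) ⇔ (p at l < p at r))

Avoids : ∀ {m k} → Permutation m → Permutation k → Set
Avoids w p = ¬ Contains w p

A : ∀ {k} (m : ℕ) → Permutation k → Set
A m p = [ w ∈ Permutation m ∣ Alternating w × Avoids w p ]

isPermutation? : ∀ {m} (w : Word m) → Dec (IsPermutation w)
isPermutation? w = all? λ a →
  map′ (λ (i , wᵢ≡a , uniq) → i , wᵢ≡a , λ {j} → uniq j)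
       (λ (i , wᵢ≡a , uniq) → i , wᵢ≡a , λ j → uniq {j})
       (any? λ i → (lookup w i ≟ a) ×-dec all? λ j → (lookup w j ≟ a) →-dec (i ≟ j))

permutation : ∀ {m} (w : Word m) {isPerm : True (isPermutation? w)} → Permutation m
permutation w {isPerm} = record { value = w ; proof = [ toWitness isPerm ] }

[2143] [1234] : Permutation 4
[2143] = permutation (1F ∷ 0F ∷ 3F ∷ 2F ∷ [])
[1234] = permutation (0F ∷ 1F ∷ 2F ∷ 3F ∷ [])

-- Fillings of the shape ⟨n, n, n⟩ by [3n], as three rows of length n.
Filling : ℕ → Set
Filling n = Vec (Vec (Fin (3 * n)) n) 3

entry : ∀ {n} → Filling n → Fin 3 → Fin n → Fin (3 * n)
entry T r c = lookup (lookup T r) c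

record IsStandard {n : ℕ} (T : Filling n) : Set where
  field
    each-once        : ∀ (a : Fin (3 * n)) → ∃! _≡_ λ ((r , c) : Fin 3 × Fin n) → entry T r c ≡ a
    rows-increase    : ∀ (r : Fin 3) (c c′ : Fin n) → c < c′ → entry T r c < entry T r c′
    columns-increase : ∀ (r r′ : Fin 3) (c : Fin n) → r < r′ → entry T r c < entry T r′ c

SYT⟨n,n,n⟩ : ℕ → Set
SYT⟨n,n,n⟩ n = [ T ∈ Filling n ∣ IsStandard T ]

denominator≢0 : ∀ n → NonZero (n ! * (n + 1) ! * (n + 2) !)
denominator≢0 n =
  m*n≢0 _ _ {{m*n≢0 _ _ {{n !≢0}} {{(n + 1) !≢0}}}} {{(n + 2) !≢0}}

{-# OPTIONS --safe #-}
module Submission where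

-- All three families grow along the same tree with labels (p, q): the root has label (0, 0), and
-- the children of a node (p, q) of depth n carry, once each, the labels (p′, q′) with p < p′ ≤ 2n +
-- 1 and q ≤ q′ < p′. A permutation grows by two new first letters c < d, inserted at sites, i.e.
-- gaps between the old values. For 1234, p and q count the sites below a 12, respectively a 123,
-- which are forbidden for d, respectively c. For 2143, p is the least site allowed for d and q the
-- number of sites forbidden for c. A tableau grows by a new first column, whose first entry is 1
-- and whose other entries T(2,1) and T(3,1) give p = 2n + 1 − T(2,1) and q = 2n + 1 − T(3,1).
--
-- The nodes of depth n with p ≤ P and q ≤ Q are equinumerous with the standard tableaux of a shape
-- with at most three rows some of whose largest entries avoid the first row; for these numbers the
-- recursion of the tree reduces to the fact that removals of entries from different rows commute.
-- The unrestricted ones are given by the hook length formula.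

open import Defs
open import Data.Empty using (⊥; ⊥-elim; ⊥-elim-irr)
open import Data.Fin.Base using (Fin; zero; suc; toℕ; fromℕ<; punchIn; punchOut; combine; remQuot; _<_; _>_)
open import Data.Fin.Patterns using (0F; 1F; 2F; 3F)
open import Data.Fin.Properties
  using (_≟_; <-cmp; toℕ<n; toℕ-injective; toℕ-fromℕ<; suc-injective; +↔⊎;
         punchIn-injective; punchInᵢ≢i; punchIn-punchOut; combine-remQuot; remQuot-combine)
open import Data.Integer.Base using (+_)
import Data.Integer.Base as ℤ
import Data.Integer.Properties as ℤ
open import Data.Irrelevant using ([_])
open import Data.Nat.Base using (ℕ; zero; suc; _+_; _*_; _∸_; _⊔_; _!; _≤_; _≥_; z≤n; s≤s; s≤s⁻¹)
import Data.Nat.Base as ℕ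
open import Data.Nat.Divisibility using (_∣_; _∤_; _∣0; ∣-refl; ∣1⇒≡1; ∣m∣n⇒∣m+n; ∣m+n∣m⇒∣n)
import Data.Nat.Properties as ℕ
open import Data.Nat.Tactic.RingSolver using (solve-∀)
open import Data.Product using (_×_; _,_; proj₁; proj₂; swap; ∃; ∃!; ∃-syntax)
open import Data.Product.Function.NonDependent.Propositional using (_×-⇔_)
open import Data.Rational.Base using (_/_)
import Data.Rational.Properties as ℚ
import Data.Rational.Unnormalised.Base as ℚᵘ
open import Data.Refinement using (Refinement-syntax; value; _,_)
open import Data.Refinement.Properties using (value-injective)
open import Data.Sum.Base using (_⊎_; inj₁; inj₂; [_,_]′)
open import Data.Sum.Function.Propositional using (_⊎-↔_; _⊎-⇔_)
open import Data.Unit.Base using (⊤; tt)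
open import Data.Vec.Base using (Vec; []; _∷_; lookup; map; tabulate)
import Data.Vec.Properties as Vec
open import Function.Base using (_∘_)
open import Function.Bundles using (_↔_; _⇔_; mk↔ₛ′; mk⇔; module Equivalence; module Inverse)
open import Function.Properties.Equivalence using (⇔-isEquivalence)
open import Function.Properties.Inverse using (↔-sym; ↔-trans)
open import Function.Related.TypeIsomorphisms using (¬-cong-⇔)
open import Level using (0ℓ)
open import Relation.Binary.Definitions using (tri<; tri≈; tri>)
open import Relation.Binary.PropositionalEquality
open import Relation.Binary.Structures using (IsEquivalence)
open import Relation.Nullary using (Dec; yes; no; ¬_)
open import Relation.Nullary.Decidable using (recompute; _×-dec_; _⊎-dec_; ¬?)
open import Relation.Unary using (Decidable)

-- By the rule for children, a node with label exactly (P + 1, Q) amounts to a node one level up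
-- with p ≤ P and q ≤ Q. The counts under two bounds are therefore double partial sums of those one
-- level up, and they call for a family of tableau numbers closed under both summations. The sum
-- over q becomes `skew-step`; the sum over p becomes the choice between the second and the third
-- row for the largest entry. This is what makes the condition on the first row necessary.
--
-- Letters are added at the front: in a code of relative ranks the parent is then obtained by
-- dropping heads, and the up-down condition concerns only the new pair and the letter after it.
--
-- For 1234 the forbidden sites form initial segments, so the labels are lengths and the children
-- can be solved for. For 2143 the sites forbidden for c need not form an interval; only their
-- number enters the label, and a discrete intermediate value argument shows that this number is
-- enough.

module ⇔ = IsEquivalence (⇔-isEquivalence {0ℓ})
open Equivalence using (to; from)

private variable
  m n k j : ℕ

-- Three-rowed shapes

-- skew t a b k counts the standard tableaux of shape ⟨a + b + k, b + k, k⟩ whose t largest entries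
-- avoid the first row, by the position of the largest entry.
mutual
  skew : ℕ → ℕ → ℕ → ℕ → ℕ
  skew zero zero zero zero = 1
  skew zero zero zero (suc k) = row₂ 0 0 0 (suc k) + row₃ 0 0 0 (suc k)
  skew zero zero (suc b) k = row₂ 0 0 (suc b) k + row₃ 0 0 (suc b) k
  skew zero (suc a) b k = skew 0 a b k + (row₂ 0 (suc a) b k + row₃ 0 (suc a) b k)
  skew (suc t) a b k = row₂ t a b k + row₃ t a b k

  row₂ : ℕ → ℕ → ℕ → ℕ → ℕ
  row₂ t a zero    k = 0
  row₂ t a (suc b) k = skew t (suc a) b k

  row₃ : ℕ → ℕ → ℕ → ℕ → ℕ
  row₃ t a b zero    = 0
  row₃ t a b (suc k) = skew t a (suc b) k

-- If the entry next below the `t` largest lies in the first row, it is the end of that row. As the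
-- first row exceeds the second, this entry may equally be removed before the other `t`, which
-- leaves a tableau counted by `skew t a b k`.
skew-step : ∀ t a b k → skew t (suc a) b k ≡ skew t a b k + skew (suc t) (suc a) b k
skew-step zero    a b k = refl
skew-step (suc t) a b k = begin
  row₂ t (suc a) b k + row₃ t (suc a) b k
    ≡⟨ cong₂ _+_ (step₂ b) (step₃ k) ⟩
  (row₂ t a b k + row₂ (suc t) (suc a) b k) + (row₃ t a b k + row₃ (suc t) (suc a) b k)
    ≡⟨ interchange (row₂ t a b k) _ _ _ ⟩
  skew (suc t) a b k + skew (suc (suc t)) (suc a) b k ∎
  where
  open ≡-Reasoning
  interchange : ∀ w x y z → (w + x) + (y + z) ≡ (w + y) + (x + z)
  interchange = solve-∀
  step₂ : ∀ b → row₂ t (suc a) b k ≡ row₂ t a b k + row₂ (suc t) (suc a) b k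
  step₂ zero    = refl
  step₂ (suc b) = skew-step t (suc a) b k
  step₃ : ∀ k → row₃ t (suc a) b k ≡ row₃ t a b k + row₃ (suc t) (suc a) b k
  step₃ zero    = refl
  step₃ (suc k) = skew-step t a (suc b) k

-- Only `b + k` boxes of the second row and `k` of the third lie outside the first row.
skew-empty : ∀ b k t a → b + (k + k) ℕ.< t → skew t a b k ≡ 0
skew-empty b k (suc t) a (s≤s le) = cong₂ _+_ (empty₂ b le) (empty₃ k le)
  where
  empty₂ : ∀ b → b + (k + k) ≤ t → row₂ t a b k ≡ 0
  empty₂ zero    _  = refl
  empty₂ (suc b) le = skew-empty b k t (suc a) le
  empty₃ : ∀ k → b + (k + k) ≤ t → row₃ t a b k ≡ 0
  empty₃ zero    _  = refl
  empty₃ (suc k) le = skew-empty (suc b) k t a (subst (_≤ t) (regroup b k) le)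
    where
    regroup : ∀ b k → b + (suc k + suc k) ≡ suc (suc b + (k + k))
    regroup = solve-∀

-- Frobenius' form of the hook length formula: hooks collects the factorials of the shifted row
-- lengths a + b + k + 2, b + k + 1, k, and closed the product of their differences.
hooks : ℕ → ℕ → ℕ → ℕ
hooks a b k = (2 + (a + (b + k))) ! * ((1 + (b + k)) ! * k !)

closed : ℕ → ℕ → ℕ → ℕ
closed a b k = suc a * (suc b * (2 + (a + b)))

boxes : ℕ → ℕ → ℕ → ℕ
boxes a b k = a + (2 * b + 3 * k)

row₁ : ℕ → ℕ → ℕ → ℕ
row₁ zero    b k = 0
row₁ (suc a) b k = skew 0 a b k

remove-largest : ∀ a b k {M} → boxes a b k ≡ suc M →
  skew 0 a b k ≡ row₁ a b k + (row₂ 0 a b k + row₃ 0 a b k)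
remove-largest zero    zero    zero    ()
remove-largest zero    zero    (suc k) _ = refl
remove-largest zero    (suc b) k       _ = refl
remove-largest (suc a) b       k       _ = refl

mutual
  -- Induction on the number of boxes by the place of the largest entry, every summand being brought
  -- to the common factor `hooks a b k`. When a row cannot be shortened, the factor `a`, `b` or `k`
  -- on the right of `formula₁`, `formula₂`, `formula₃` vanishes, so these hold at the boundary as
  -- well. What remains is the polynomial identity `collect`.
  skew-formula : ∀ N a b k → boxes a b k ≡ N → skew 0 a b k * hooks a b k ≡ N ! * closed a b k
  skew-formula zero    zero    zero    zero    _  = refl
  skew-formula (suc M) a b k eq = begin
    skew 0 a b k * h
      ≡⟨ cong (_* h) (remove-largest a b k eq) ⟩
    (row₁ a b k + (row₂ 0 a b k + row₃ 0 a b k)) * h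
      ≡⟨ expand (row₁ a b k) (row₂ 0 a b k) (row₃ 0 a b k) h ⟩
    row₁ a b k * h + (row₂ 0 a b k * h + row₃ 0 a b k * h)
      ≡⟨ cong₂ _+_ (formula₁ M a b k eq) (cong₂ _+_ (formula₂ M a b k eq) (formula₃ M a b k eq)) ⟩
    M ! * (a * (suc b * ((1 + (a + b)) * (2 + (a + (b + k)))))) +
      (M ! * ((2 + a) * (b * ((2 + (a + b)) * (1 + (b + k))))) +
       M ! * (suc a * ((2 + b) * ((3 + (a + b)) * k))))
      ≡⟨ collect (M !) a b k ⟩
    (boxes a b k * M !) * closed a b k
      ≡⟨ cong (λ N → (N * M !) * closed a b k) eq ⟩
    (suc M) ! * closed a b k ∎
    where
    open ≡-Reasoning
    h = hooks a b k
    expand : ∀ x y z h → (x + (y + z)) * h ≡ x * h + (y * h + z * h)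
    expand = solve-∀
    collect : ∀ f a b k →
      f * (a * (suc b * ((1 + (a + b)) * (2 + (a + (b + k)))))) +
      (f * ((2 + a) * (b * ((2 + (a + b)) * (1 + (b + k))))) +
       f * (suc a * ((2 + b) * ((3 + (a + b)) * k))))
      ≡ ((a + (2 * b + 3 * k)) * f) * (suc a * (suc b * (2 + (a + b))))
    collect = solve-∀

  formula₁ : ∀ M a b k → boxes a b k ≡ suc M → row₁ a b k * hooks a b k ≡
    M ! * (a * (suc b * ((1 + (a + b)) * (2 + (a + (b + k))))))
  formula₁ M zero    b k eq = sym (ℕ.*-zeroʳ (M !))
  formula₁ M (suc a) b k eq = begin
    skew 0 a b k * hooks (suc a) b k
      ≡⟨ move (skew 0 a b k) (3 + (a + (b + k))) ((2 + (a + (b + k))) !) ((1 + (b + k)) ! * k !) ⟩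
    (skew 0 a b k * hooks a b k) * (3 + (a + (b + k)))
      ≡⟨ cong (_* (3 + (a + (b + k)))) (skew-formula M a b k (ℕ.suc-injective eq)) ⟩
    (M ! * closed a b k) * (3 + (a + (b + k)))
      ≡⟨ done (M !) a b k ⟩
    M ! * (suc a * (suc b * ((1 + (suc a + b)) * (2 + (suc a + (b + k)))))) ∎
    where
    open ≡-Reasoning
    move : ∀ s x f g → s * ((x * f) * g) ≡ (s * (f * g)) * x
    move = solve-∀
    done : ∀ f a b k → (f * (suc a * (suc b * (2 + (a + b))))) * (3 + (a + (b + k)))
      ≡ f * (suc a * (suc b * ((1 + (suc a + b)) * (2 + (suc a + (b + k))))))
    done = solve-∀

  formula₂ : ∀ M a b k → boxes a b k ≡ suc M → row₂ 0 a b k * hooks a b k ≡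
    M ! * ((2 + a) * (b * ((2 + (a + b)) * (1 + (b + k)))))
  formula₂ M a zero    k eq = sym (trans (cong (M ! *_) (ℕ.*-zeroʳ (2 + a))) (ℕ.*-zeroʳ (M !)))
  formula₂ M a (suc b) k eq = begin
    skew 0 (suc a) b k * hooks a (suc b) k
      ≡⟨ cong (λ n → skew 0 (suc a) b k * ((2 + n) ! * ((2 + (b + k)) ! * k !))) (ℕ.+-suc a (b + k)) ⟩
    skew 0 (suc a) b k * ((3 + (a + (b + k))) ! * ((2 + (b + k)) ! * k !))
      ≡⟨ move (skew 0 (suc a) b k) (2 + (b + k)) ((3 + (a + (b + k))) !) ((1 + (b + k)) !) (k !) ⟩
    (skew 0 (suc a) b k * hooks (suc a) b k) * (2 + (b + k))
      ≡⟨ cong (_* (2 + (b + k))) (skew-formula M (suc a) b k (ℕ.suc-injective (trans (fewer a b k) eq))) ⟩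
    (M ! * closed (suc a) b k) * (2 + (b + k))
      ≡⟨ done (M !) a b k ⟩
    M ! * ((2 + a) * (suc b * ((2 + (a + suc b)) * (1 + (suc b + k))))) ∎
    where
    open ≡-Reasoning
    move : ∀ s x e f g → s * (e * ((x * f) * g)) ≡ (s * (e * (f * g))) * x
    move = solve-∀
    fewer : ∀ a b k → suc (suc a + (2 * b + 3 * k)) ≡ a + (2 * suc b + 3 * k)
    fewer = solve-∀
    done : ∀ f a b k → (f * (suc (suc a) * (suc b * (2 + (suc a + b))))) * (2 + (b + k))
      ≡ f * ((2 + a) * (suc b * ((2 + (a + suc b)) * (1 + (suc b + k)))))
    done = solve-∀

  formula₃ : ∀ M a b k → boxes a b k ≡ suc M → row₃ 0 a b k * hooks a b k ≡
    M ! * (suc a * ((2 + b) * ((3 + (a + b)) * k)))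
  formula₃ M a b zero    eq = sym (vanish (M !) a b)
    where
    vanish : ∀ f a b → f * (suc a * ((2 + b) * ((3 + (a + b)) * 0))) ≡ 0
    vanish = solve-∀
  formula₃ M a b (suc k) eq = begin
    skew 0 a (suc b) k * hooks a b (suc k)
      ≡⟨ cong (λ n → skew 0 a (suc b) k * ((2 + (a + n)) ! * ((1 + n) ! * (suc k) !))) (ℕ.+-suc b k) ⟩
    skew 0 a (suc b) k * ((2 + (a + (suc b + k))) ! * ((1 + (suc b + k)) ! * (suc k) !))
      ≡⟨ move (skew 0 a (suc b) k) (suc k) ((2 + (a + (suc b + k))) !) ((1 + (suc b + k)) !) (k !) ⟩
    (skew 0 a (suc b) k * hooks a (suc b) k) * suc k
      ≡⟨ cong (_* suc k) (skew-formula M a (suc b) k (ℕ.suc-injective (trans (fewer a b k) eq))) ⟩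
    (M ! * closed a (suc b) k) * suc k
      ≡⟨ done (M !) a b k ⟩
    M ! * (suc a * ((2 + b) * ((3 + (a + b)) * suc k))) ∎
    where
    open ≡-Reasoning
    move : ∀ s x e f g → s * (e * (f * (x * g))) ≡ (s * (e * (f * g))) * x
    move = solve-∀
    fewer : ∀ a b k → suc (a + (2 * suc b + 3 * k)) ≡ a + (2 * b + 3 * suc k)
    fewer = solve-∀
    done : ∀ f a b k → (f * (suc a * (suc (suc b) * (2 + (a + suc b))))) * suc k
      ≡ f * (suc a * ((2 + b) * ((3 + (a + b)) * suc k)))
    done = solve-∀

fraction : ∀ M N D .{{_ : ℕ.NonZero D}} → N * D ≡ M → (+ N) / 1 ≡ (+ M) / D
fraction M N (suc d) eq = ℚ.fromℚᵘ-cong {ℚᵘ.mkℚᵘ (+ N) 0} {ℚᵘ.mkℚᵘ (+ M) d} (ℚᵘ.*≡* (begin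
  (+ N) ℤ.* (+ suc d)  ≡⟨ ℤ.pos-* N (suc d) ⟨
  + (N * suc d)        ≡⟨ cong +_ eq ⟩
  + M                  ≡⟨ ℤ.*-identityʳ (+ M) ⟨
  (+ M) ℤ.* (+ 1)      ∎))
  where open ≡-Reasoning

skew-closed : ∀ n → skew 0 0 0 n * (n ! * (n + 1) ! * (n + 2) !) ≡ 2 * (3 * n) !
skew-closed n = begin
  skew 0 0 0 n * (n ! * (n + 1) ! * (n + 2) !)
    ≡⟨ cong₂ (λ i j → skew 0 0 0 n * (n ! * i ! * j !)) (ℕ.+-comm n 1) (ℕ.+-comm n 2) ⟩
  skew 0 0 0 n * (n ! * (1 + n) ! * (2 + n) !)
    ≡⟨ reorder (skew 0 0 0 n) (n !) ((1 + n) !) ((2 + n) !) ⟩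
  skew 0 0 0 n * hooks 0 0 n
    ≡⟨ skew-formula (3 * n) 0 0 n refl ⟩
  (3 * n) ! * 2
    ≡⟨ ℕ.*-comm ((3 * n) !) 2 ⟩
  2 * (3 * n) ! ∎
  where
  open ≡-Reasoning
  reorder : ∀ s x y z → s * (x * y * z) ≡ s * (z * (y * x))
  reorder = solve-∀

-- Generating trees

module _ {X Y : Set} {P : X → Set} {Q : Y → Set} (P? : Decidable P) (Q? : Decidable Q) where

  -- Membership proofs are irrelevant, whereas `preimage` and `f-inj` consume relevant ones; the
  -- deciders serve to recompute them.
  refinement-↔ : (f : X → Y) → (∀ {x} → P x → Q (f x)) →
    (∀ {y} → Q y → ∃ λ x → P x × f x ≡ y) →
    (∀ {x x′} → P x → P x′ → f x ≡ f x′ → x ≡ x′) →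
    [ x ∈ X ∣ P x ] ↔ [ y ∈ Y ∣ Q y ]
  refinement-↔ f f-Q preimage f-inj = mk↔ₛ′ forth back forth-back back-forth
    where
    forth : [ x ∈ X ∣ P x ] → [ y ∈ Y ∣ Q y ]
    forth (x , [ Px ]) = f x , [ f-Q Px ]
    preimage′ : (y : [ y ∈ Y ∣ Q y ]) → ∃ λ x → P x × f x ≡ value y
    preimage′ (y , [ Qy ]) = preimage (recompute (Q? y) Qy)
    back : [ y ∈ Y ∣ Q y ] → [ x ∈ X ∣ P x ]
    back y = proj₁ (preimage′ y) , [ proj₁ (proj₂ (preimage′ y)) ]
    forth-back : ∀ y → forth (back y) ≡ y
    forth-back y = value-injective (proj₂ (proj₂ (preimage′ y)))
    back-forth : ∀ x → back (forth x) ≡ x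
    back-forth z@(x , [ Px ]) with x′ , Px′ , eq ← preimage′ (forth z) =
      value-injective (f-inj Px′ (recompute (P? x) Px) eq)

module _ {X : Set} {P : X → Set} where

  size-⇔ : ∀ {Q : X → Set} {N} → (∀ {x} → P x → Q x) → (∀ {x} → Q x → P x) →
    HasSize [ x ∈ X ∣ P x ] N → HasSize [ x ∈ X ∣ Q x ] N
  size-⇔ forth back = ↔-trans (mk↔ₛ′
    (λ (x , [ q ]) → x , [ back q ]) (λ (x , [ p ]) → x , [ forth p ]) (λ _ → refl) (λ _ → refl))

  size-empty : (∀ {x} → ¬ P x) → HasSize [ x ∈ X ∣ P x ] 0
  size-empty none = mk↔ₛ′ (λ (_ , [ p ]) → ⊥-elim-irr (none p)) (λ ()) (λ ())
    (λ (_ , [ p ]) → ⊥-elim-irr (none p))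

  size-split : ∀ {R : X → Set} {M N} → Decidable R →
    HasSize [ x ∈ X ∣ P x × R x ] M → HasSize [ x ∈ X ∣ P x × ¬ R x ] N →
    HasSize [ x ∈ X ∣ P x ] (M + N)
  size-split {R} R? size₁ size₂ = ↔-trans (mk↔ₛ′ forth back forth-back back-forth)
    (↔-trans (size₁ ⊎-↔ size₂) (↔-sym +↔⊎))
    where
    Parts = [ x ∈ X ∣ P x × R x ] ⊎ [ x ∈ X ∣ P x × ¬ R x ]
    place : ∀ x → Dec (R x) → .(P x) → Parts
    place x (yes r) p = inj₁ (x , [ p , r ])
    place x (no ¬r) p = inj₂ (x , [ p , ¬r ])
    forth : [ x ∈ X ∣ P x ] → Parts
    forth (x , [ p ]) = place x (R? x) p
    back : Parts → [ x ∈ X ∣ P x ]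
    back (inj₁ (x , [ pr ])) = x , [ proj₁ pr ]
    back (inj₂ (x , [ pr ])) = x , [ proj₁ pr ]
    forth-back : ∀ y → forth (back y) ≡ y
    forth-back (inj₁ (x , [ pr ])) with R? x
    ... | yes _ = refl
    ... | no ¬r = ⊥-elim (¬r (recompute (R? x) (proj₂ pr)))
    forth-back (inj₂ (x , [ pr ])) with R? x
    ... | yes r = ⊥-elim (recompute (¬? (R? x)) (proj₂ pr) r)
    ... | no _  = refl
    back-forth : ∀ x → back (forth x) ≡ x
    back-forth (x , [ p ]) with R? x
    ... | yes _ = refl
    ... | no _  = refl

record GeneratingTree (C : ℕ → Set) (V : ∀ {n} → C n → Set) : Set where
  field
    valid?       : ∀ {n} (c : C n) → Dec (V c)
    p q          : ∀ {n} → C n → ℕ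
    root         : C 0
    root-valid   : V root
    root-unique  : ∀ c → c ≡ root
    root-p       : p root ≡ 0
    root-q       : q root ≡ 0
    parent       : ∀ {n} → C (suc n) → C n
    parent-valid : ∀ {n} {c : C (suc n)} → V c → V (parent c)
    p-increases  : ∀ {n} {c : C (suc n)} → V c → p (parent c) ℕ.< p c
    p-bounded    : ∀ {n} {c : C (suc n)} → V c → p c ≤ suc (n * 2)
    q-monotone   : ∀ {n} {c : C (suc n)} → V c → q (parent c) ≤ q c
    q<p          : ∀ {n} {c : C (suc n)} → V c → q c ℕ.< p c
    label-unique : ∀ {n} {c c′ : C (suc n)} → V c → V c′ →
                   parent c ≡ parent c′ → p c ≡ p c′ → q c ≡ q c′ → c ≡ c′
    child        : ∀ {n} {u : C n} {p′ q′} → V u →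
                   p u ℕ.< p′ → p′ ≤ suc (n * 2) → q u ≤ q′ → q′ ℕ.< p′ →
                   ∃ λ (c : C (suc n)) → V c × parent c ≡ u × p c ≡ p′ × q c ≡ q′

  depth≤p : ∀ {n} {c : C n} → V c → n ≤ p c
  depth≤p {zero}  _ = z≤n
  depth≤p {suc n} v = ℕ.≤-<-trans (depth≤p (parent-valid v)) (p-increases v)

  Below : ∀ n → ℕ → ℕ → C n → Set
  Below n P Q c = V c × p c ≤ P × q c ≤ Q

  Row : ∀ n → ℕ → ℕ → C (suc n) → Set
  Row n P Q c = V c × p c ≡ suc P × q c ≤ Q

  -- A node has a child labelled (P + 1, Q) exactly when its own labels are at most P and Q, and
  -- then only one. Hence `parent` is a bijection.
  cell : ∀ n P Q {N} → Q ≤ P → P ≤ n * 2 → HasSize [ u ∈ C n ∣ Below n P Q u ] N →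
    HasSize [ c ∈ C (suc n) ∣ V c × p c ≡ suc P × q c ≡ Q ] N
  cell n P Q Q≤P P≤2n = ↔-trans (refinement-↔
    (λ c → valid? c ×-dec p c ℕ.≟ suc P ×-dec q c ℕ.≟ Q)
    (λ u → valid? u ×-dec p u ℕ.≤? P ×-dec q u ℕ.≤? Q)
    parent
    (λ (v , p≡ , q≡) → parent-valid v , s≤s⁻¹ (ℕ.≤-trans (p-increases v) (ℕ.≤-reflexive p≡)) ,
                       ℕ.≤-trans (q-monotone v) (ℕ.≤-reflexive q≡))
    (λ (v , p≤ , q≤) → let c , v′ , parent≡ , labels = child v (s≤s p≤) (s≤s P≤2n) q≤ (s≤s Q≤P)
                       in c , (v′ , labels) , parent≡)
    (λ (v , p≡ , q≡) (v′ , p≡′ , q≡′) eq →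
      label-unique v v′ eq (trans p≡ (sym p≡′)) (trans q≡ (sym q≡′))))

  private
    -- The first two rows have equal length, so the largest entry of this nonempty shape cannot end
    -- the first row.
    skew-top : ∀ b k {n} → suc n ≡ b + k → skew 1 0 b k ≡ skew 0 0 b k
    skew-top zero    (suc k) _ = refl
    skew-top (suc b) k       _ = refl

  -- In terms of tableaux of shape ⟨n, n, n⟩, the bounds p ≤ P and q ≤ Q say that the 2n − P largest
  -- entries lie in the third row and the next P − Q ones avoid the first row. Hence the parameters
  -- k = P − n, b = 2n − P and t = P − Q.
  mutual
    size-below : ∀ n b k t {P Q} → n ≡ b + k → P ≡ b + (k + k) → P ≡ Q + t →
      HasSize [ c ∈ C n ∣ Below n P Q c ] (skew t 0 b k)
    size-below zero zero zero t {Q = zero} refl refl refl = mk↔ₛ′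
      (λ _ → Fin.zero) (λ _ → root , [ root-valid , ℕ.≤-reflexive root-p , ℕ.≤-reflexive root-q ])
      (λ { Fin.zero → refl ; (Fin.suc ()) }) (λ (c , _) → value-injective (sym (root-unique c)))
    size-below (suc n) b k zero {P} {zero} eqn refl eqQ =
      ⊥-elim (ℕ.1+n≢0 (trans eqn (ℕ.n≤0⇒n≡0 (ℕ.≤-trans (ℕ.+-monoʳ-≤ b (ℕ.m≤m+n k k)) (ℕ.≤-reflexive eqQ)))))
    -- For `t = 0` both bounds equal P, and `q<p` already forces q ≤ P - 1. Lowering the bound on q
    -- makes `t` equal to 1, which `skew-top` matches.
    size-below (suc n) b k zero {P} {suc Q} eqn eqP eqQ =
      subst (HasSize _) (skew-top b k eqn)
        (size-⇔
          (λ (v , p≤ , q≤) → v , p≤ , ℕ.m≤n⇒m≤1+n q≤)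
          (λ (v , p≤ , q≤) → v , p≤ , s≤s⁻¹ (ℕ.≤-trans (q<p v) (ℕ.≤-trans p≤ (ℕ.≤-reflexive (trans eqQ (ℕ.+-identityʳ _))))))
          (size-below⁺ n b k 0 eqn eqP (trans eqQ (sym (ℕ.+-suc Q 0)))))
    size-below (suc n) b k (suc t) = size-below⁺ n b k t

    -- The cases p = P and p < P correspond to the largest entry in the second and in the third row;
    -- the positive first argument of `skew` keeps it out of the first.
    size-below⁺ : ∀ n b k t {P Q} → suc n ≡ b + k → P ≡ b + (k + k) → P ≡ Q + suc t →
      HasSize [ c ∈ C (suc n) ∣ Below (suc n) P Q c ] (skew (suc t) 0 b k)
    -- Here P is twice the depth, a value that `p-bounded` excludes for p, so P drops by one.
    -- Likewise the only corner of a rectangle lies in the third row.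
    size-below⁺ n zero (suc k) t {Q = Q} refl refl eqQ =
      size-⇔
        (λ (v , p≤ , q≤) → v , ℕ.m≤n⇒m≤1+n p≤ , q≤)
        (λ (v , p≤ , q≤) → v , ℕ.≤-trans (p-bounded v) (ℕ.≤-reflexive (odd k)) , q≤)
        (size-below (suc n) 1 k t refl (ℕ.+-suc k k) (ℕ.suc-injective (trans eqQ (ℕ.+-suc Q t))))
      where
      odd : ∀ k → suc (k * 2) ≡ k + suc k
      odd = solve-∀
    size-below⁺ n (suc b) k t {Q = Q} refl refl eqQ =
      size-split (λ c → p c ℕ.≟ suc (b + (k + k)))
        (size-⇔
          (λ (v , p≡ , q≤) → (v , ℕ.≤-reflexive p≡ , q≤) , p≡)
          (λ ((v , p≤ , q≤) , p≡) → v , p≡ , q≤)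
          (size-row (b + k) b k t refl refl eqQ′))
        (size-⇔
          (λ (v , p≤ , q≤) → (v , ℕ.m≤n⇒m≤1+n p≤ , q≤) , λ p≡ → ℕ.<-irrefl p≡ (s≤s p≤))
          (λ ((v , p≤ , q≤) , p≢) → v , s≤s⁻¹ (ℕ.≤∧≢⇒< p≤ p≢) , q≤)
          (lower k refl))
      where
      eqQ′ : b + (k + k) ≡ Q + t
      eqQ′ = ℕ.suc-injective (trans eqQ (ℕ.+-suc Q t))
      lower : ∀ k′ → k ≡ k′ →
        HasSize [ c ∈ C (suc (b + k)) ∣ Below (suc (b + k)) (b + (k + k)) Q c ] (row₃ t 0 (suc b) k′)
      -- The bound on p is now below the depth, against `depth≤p`; the third row is empty.
      lower zero refl = size-empty λ (v , p≤ , _) → ℕ.<-irrefl refl (ℕ.≤-trans (depth≤p v) p≤)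
      lower (suc k′) refl = size-below (suc (b + k)) (2 + b) k′ t
        (cong suc (ℕ.+-suc b k′)) (more b k′) eqQ′
        where
        more : ∀ b k′ → b + (suc k′ + suc k′) ≡ 2 + (b + (k′ + k′))
        more = solve-∀

    -- The split into q = Q and q < Q is `skew-step`: `cell` counts the first part, and in the
    -- second Q drops while `t` grows. At Q = 0 the second part is empty, and `skew-empty` says the
    -- same of its tableaux, as then `t = b + 2k`.
    size-row : ∀ n b k t {P Q} → n ≡ b + k → P ≡ b + (k + k) → P ≡ Q + t →
      HasSize [ c ∈ C (suc n) ∣ Row n P Q c ] (skew t 1 b k)
    size-row n b k t {P} {zero} refl refl refl =
      subst (HasSize _) (sym skew≡)
        (size-⇔
          (λ (v , p≡ , q≡) → v , p≡ , ℕ.≤-reflexive q≡)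
          (λ (v , p≡ , q≤) → v , p≡ , ℕ.n≤0⇒n≡0 q≤)
          (cell n P 0 z≤n (P≤2n b k) (size-below n b k t refl refl refl)))
      where
      skew≡ : skew t 1 b k ≡ skew t 0 b k
      skew≡ = trans (skew-step t 0 b k)
        (trans (cong (λ x → skew t 0 b k + x) (skew-empty b k (suc t) 1 ℕ.≤-refl)) (ℕ.+-identityʳ _))
    size-row n b k t {P} {suc Q} refl refl eqQ =
      subst (HasSize _) (sym (skew-step t 0 b k))
        (size-split (λ c → q c ℕ.≟ suc Q)
          (size-⇔
            (λ (v , p≡ , q≡) → (v , p≡ , ℕ.≤-reflexive q≡) , q≡)
            (λ ((v , p≡ , _) , q≡) → v , p≡ , q≡)
            (cell n P (suc Q) (ℕ.m+n≤o⇒m≤o (suc Q) (ℕ.≤-reflexive (sym eqQ))) (P≤2n b k)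
              (size-below n b k t refl refl eqQ)))
          (size-⇔
            (λ (v , p≡ , q≤) → (v , p≡ , ℕ.m≤n⇒m≤1+n q≤) , λ q≡ → ℕ.<-irrefl q≡ (s≤s q≤))
            (λ ((v , p≡ , q≤) , q≢) → v , p≡ , s≤s⁻¹ (ℕ.≤∧≢⇒< q≤ q≢))
            (size-row n b k (suc t) refl refl (trans eqQ (sym (ℕ.+-suc Q t))))))

    private
      P≤2n : ∀ b k → b + (k + k) ≤ (b + k) * 2
      P≤2n b k = ℕ.≤-trans (ℕ.m≤m+n _ b) (ℕ.≤-reflexive (regroup b k))
        where
        regroup : ∀ b k → (b + (k + k)) + b ≡ (b + k) * 2
        regroup = solve-∀

  size : ∀ n → HasSize [ c ∈ C n ∣ V c ] (skew 0 0 0 n)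
  -- With P = Q = 2n the bounds hold at every node of depth n, and the shape is the full rectangle.
  size n = size-⇔ proj₁ (λ v → v , p≤ v , ℕ.≤-trans (q≤p v) (p≤ v)) (size-below n 0 n 0 refl refl (sym (ℕ.+-identityʳ _)))
    where
    p≤ : ∀ {n} {c : C n} → V c → p c ≤ n + n
    p≤ {zero}  {c} _ = ℕ.≤-reflexive (trans (cong p (root-unique c)) root-p)
    p≤ {suc n} v = ℕ.≤-trans (p-bounded v) (s≤s (ℕ.≤-trans (ℕ.≤-reflexive (twice n)) (ℕ.+-monoʳ-≤ n (ℕ.n≤1+n n))))
      where
      twice : ∀ n → n * 2 ≡ n + n
      twice = solve-∀
    q≤p : ∀ {n} {c : C n} → V c → q c ≤ p c
    q≤p {zero}  {c} _ = ℕ.≤-reflexive (trans (cong q (root-unique c)) (trans root-q (sym (trans (cong p (root-unique c)) root-p))))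
    q≤p {suc n} v = ℕ.<⇒≤ (q<p v)

-- Codes of permutations

-- A permutation is coded by its relative ranks: the head v of a code is the number of letters
-- of the remaining word that lie below the first letter.
data Code : ℕ → Set where
  []  : Code 0
  _∷_ : Fin (suc m) → Code m → Code (suc m)

word : Code m → Word m
word []      = []
word (v ∷ c) = v ∷ map (punchIn v) (word c)

word-isPermutation : (c : Code m) → IsPermutation (word c)
word-isPermutation (v ∷ c) a with v ≟ a
... | yes v≡a = zero , v≡a , λ
  { {zero}  _  → refl
  ; {suc j} eq → ⊥-elim (punchInᵢ≢i v (lookup (word c) j)
                   (trans (sym (Vec.lookup-map j (punchIn v) (word c))) (trans eq (sym v≡a)))) }
... | no v≢a with i , eqᵢ , unique ← word-isPermutation c (punchOut v≢a) =
  suc i ,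
  trans (Vec.lookup-map i (punchIn v) (word c)) (trans (cong (punchIn v) eqᵢ) (punchIn-punchOut v≢a)) ,
  λ { {zero}  eq → ⊥-elim (v≢a eq)
    ; {suc j} eq → cong suc (unique (punchIn-injective v _ _
        (trans (sym (Vec.lookup-map j (punchIn v) (word c))) (trans eq (sym (punchIn-punchOut v≢a)))))) }

letter-occurs : (c : Code m) (a : Fin m) → ∃ λ i → lookup (word c) i ≡ a
letter-occurs c a with i , eq , _ ← word-isPermutation c a = i , eq

module _ {A B : Set} {f : A → B} (f-inj : ∀ {x y} → f x ≡ f y → x ≡ y) where

  map-injective : {xs ys : Vec A m} → map f xs ≡ map f ys → xs ≡ ys
  map-injective {xs = []}     {[]}     _  = refl
  map-injective {xs = x ∷ xs} {y ∷ ys} eq =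
    cong₂ _∷_ (f-inj (Vec.∷-injectiveˡ eq)) (map-injective (Vec.∷-injectiveʳ eq))

word-injective : {c c′ : Code m} → word c ≡ word c′ → c ≡ c′
word-injective {c = []}    {[]}      _  = refl
word-injective {c = v ∷ c} {v′ ∷ c′} eq with refl ← Vec.∷-injectiveˡ eq =
  cong (v ∷_) (word-injective (map-injective (punchIn-injective v _ _) (Vec.∷-injectiveʳ eq)))

word-surjective : (w : Word m) → IsPermutation w → ∃ λ c → word c ≡ w
word-surjective []       _    = [] , refl
word-surjective {suc m} (v ∷ xs) perm =
  let c , eq = word-surjective ys ys-perm
  in v ∷ c , cong (v ∷_) (trans (cong (map (punchIn v)) eq) map-ys)
  where
  distinct : ∀ i → v ≢ lookup xs i
  distinct i v≡ with _ , _ , unique ← perm v with () ← trans (sym (unique {zero} refl)) (unique {suc i} (sym v≡))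
  ys : Word m
  ys = tabulate λ i → punchOut (distinct i)
  punchIn-ys : ∀ i → punchIn v (lookup ys i) ≡ lookup xs i
  punchIn-ys i = trans (cong (punchIn v) (Vec.lookup∘tabulate _ i)) (punchIn-punchOut (distinct i))
  map-ys : map (punchIn v) ys ≡ xs
  map-ys = begin
    map (punchIn v) ys                  ≡⟨ Vec.tabulate∘lookup (map (punchIn v) ys) ⟨
    tabulate (lookup (map (punchIn v) ys))
      ≡⟨ Vec.tabulate-cong (λ i → trans (Vec.lookup-map i (punchIn v) ys) (punchIn-ys i)) ⟩
    tabulate (lookup xs)                ≡⟨ Vec.tabulate∘lookup xs ⟩
    xs                                  ∎
    where open ≡-Reasoning
  ys-perm : IsPermutation ys
  ys-perm a with perm (punchIn v a)
  ... | zero  , eq , _      = ⊥-elim (punchInᵢ≢i v a (sym eq))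
  ... | suc i , eq , unique = i , punchIn-injective v _ _ (trans (punchIn-ys i) eq) ,
    λ {j} eqⱼ → suc-injective (unique {suc j} (trans (sym (punchIn-ys j)) (cong (punchIn v) eqⱼ)))

code↔permutation : Code m ↔ Permutation m
code↔permutation {m} = mk↔ₛ′ encode decode encode-decode decode-encode
  where
  encode : Code m → Permutation m
  encode c = word c , [ word-isPermutation c ]
  decode′ : (w : Permutation m) → ∃ λ c → word c ≡ value w
  decode′ (w , [ perm ]) = word-surjective w (recompute (isPermutation? w) perm)
  decode : Permutation m → Code m
  decode w = proj₁ (decode′ w)
  encode-decode : ∀ w → encode (decode w) ≡ w
  encode-decode w = value-injective (proj₂ (decode′ w))
  decode-encode : ∀ c → decode (encode c) ≡ c
  decode-encode c = word-injective (proj₂ (decode′ (encode c)))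

-- This form of "some subsequence of length `j` satisfies `Q`" splits by computation, when a first
-- letter is adjoined, into the occurrences that use it and those that do not.
-- `Subsequence-positions` relates it to the position vectors of `Contains`.
Subsequence : {A : Set} (j : ℕ) → (Vec A j → Set) → Vec A m → Set
Subsequence zero    Q xs       = Q []
Subsequence (suc j) Q []       = ⊥
Subsequence (suc j) Q (x ∷ xs) = Subsequence j (λ ys → Q (x ∷ ys)) xs ⊎ Subsequence (suc j) Q xs

module _ {A : Set} where

  Subsequence-mono : ∀ j {Q R : Vec A j → Set} → (∀ ys → Q ys → R ys) → (xs : Vec A m) → Subsequence j Q xs → Subsequence j R xs
  Subsequence-mono zero    f xs       = f []
  Subsequence-mono (suc j) f (x ∷ xs) (inj₁ here)  = inj₁ (Subsequence-mono j (λ ys → f (x ∷ ys)) xs here)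
  Subsequence-mono (suc j) f (x ∷ xs) (inj₂ there) = inj₂ (Subsequence-mono (suc j) f xs there)

  Subsequence-cong : ∀ j {Q R : Vec A j → Set} → (∀ ys → Q ys ⇔ R ys) → (xs : Vec A m) → Subsequence j Q xs ⇔ Subsequence j R xs
  Subsequence-cong j Q⇔R xs = mk⇔ (Subsequence-mono j (to ∘ Q⇔R) xs) (Subsequence-mono j (from ∘ Q⇔R) xs)

  Subsequence-const : ∀ j {B : Set} (xs : Vec A m) → Subsequence j (λ _ → B) xs → B
  Subsequence-const zero    xs       b = b
  Subsequence-const (suc j) (x ∷ xs) (inj₁ here)  = Subsequence-const j xs here
  Subsequence-const (suc j) (x ∷ xs) (inj₂ there) = Subsequence-const (suc j) xs there

  Subsequence-× : ∀ j {B : Set} {Q : Vec A j → Set} (xs : Vec A m) → Subsequence j (λ ys → B × Q ys) xs ⇔ (B × Subsequence j Q xs)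
  Subsequence-× j xs = mk⇔
    (λ s → Subsequence-const j xs (Subsequence-mono j (λ _ → proj₁) xs s) , Subsequence-mono j (λ _ → proj₂) xs s)
    (λ (b , s) → Subsequence-mono j (λ _ q → b , q) xs s)

Subsequence-map : ∀ {A B : Set} (f : A → B) j {Q : Vec B j → Set} (xs : Vec A m) →
  Subsequence j Q (map f xs) ⇔ Subsequence j (Q ∘ map f) xs
Subsequence-map f zero    xs       = ⇔.refl
Subsequence-map f (suc j) []       = ⇔.refl
Subsequence-map f (suc j) (x ∷ xs) = Subsequence-map f j xs ⊎-⇔ Subsequence-map f (suc j) xs

Increasing : Vec (Fin m) j → Set
Increasing ι = ∀ l r → l < r → lookup ι l < lookup ι r

private
  map-suc : (ι : Vec (Fin (suc m)) j) → (∀ l → zero {m} < lookup ι l) → ∃ λ κ → map suc κ ≡ ι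
  map-suc []          _   = [] , refl
  map-suc (zero ∷ ι)  pos with () ← pos zero
  map-suc (suc i ∷ ι) pos with κ , refl ← map-suc ι (pos ∘ suc) = i ∷ κ , refl

  increasing-map-suc : (κ : Vec (Fin m) j) → Increasing κ → Increasing (map suc κ)
  increasing-map-suc κ inc l r l<r =
    subst₂ _<_ (sym (Vec.lookup-map l suc κ)) (sym (Vec.lookup-map r suc κ)) (s≤s (inc l r l<r))

  increasing-map-suc⁻ : (κ : Vec (Fin m) j) → Increasing (map suc κ) → Increasing κ
  increasing-map-suc⁻ κ inc l r l<r =
    s≤s⁻¹ (subst₂ _<_ (Vec.lookup-map l suc κ) (Vec.lookup-map r suc κ) (inc l r l<r))

  increasing-∷ : (κ : Vec (Fin m) j) → Increasing κ → Increasing (zero ∷ map suc κ)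
  increasing-∷ κ inc zero    (suc r) _         = subst (λ i → 0 ℕ.< toℕ i) (sym (Vec.lookup-map r suc κ)) (s≤s z≤n)
  increasing-∷ κ inc (suc l) (suc r) (s≤s l<r) = increasing-map-suc κ inc l r l<r

  map-lookup-suc : ∀ {A : Set} (x : A) (xs : Vec A m) (κ : Vec (Fin m) j) →
    map (lookup (x ∷ xs)) (map suc κ) ≡ map (lookup xs) κ
  map-lookup-suc x xs κ = sym (Vec.map-∘ (lookup (x ∷ xs)) suc κ)

Subsequence-positions : ∀ {A : Set} j {Q : Vec A j → Set} (xs : Vec A m) →
  Subsequence j Q xs ⇔ ∃ λ (ι : Vec (Fin m) j) → Increasing ι × Q (map (lookup xs) ι)
Subsequence-positions j xs = mk⇔ (positions j xs) (λ (ι , inc , q) → subsequence j xs ι inc q)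
  where
  positions : ∀ {A : Set} {m} j {Q : Vec A j → Set} (xs : Vec A m) →
    Subsequence j Q xs → ∃ λ (ι : Vec (Fin m) j) → Increasing ι × Q (map (lookup xs) ι)
  positions zero xs q = [] , (λ ()) , q
  positions (suc j) {Q} (x ∷ xs) (inj₁ here) with κ , inc , q ← positions j xs here =
    zero ∷ map suc κ , increasing-∷ κ inc , subst (λ ys → Q (x ∷ ys)) (sym (map-lookup-suc x xs κ)) q
  positions (suc j) {Q} (x ∷ xs) (inj₂ there) with κ , inc , q ← positions (suc j) xs there =
    map suc κ , increasing-map-suc κ inc , subst Q (sym (map-lookup-suc x xs κ)) q

  subsequence : ∀ {A : Set} {m} j {Q : Vec A j → Set} (xs : Vec A m) (ι : Vec (Fin m) j) →
    Increasing ι → Q (map (lookup xs) ι) → Subsequence j Q xs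
  subsequence zero    xs       []      _   q = q
  subsequence (suc j) []       (() ∷ _)
  subsequence (suc j) {Q} (x ∷ xs) (zero ∷ ι) inc q
    with κ , refl ← map-suc ι (λ l → inc zero (suc l) (s≤s z≤n)) =
    inj₁ (subsequence j xs κ (increasing-map-suc⁻ κ (λ l r l<r → inc (suc l) (suc r) (s≤s l<r)))
      (subst (λ ys → Q (x ∷ ys)) (map-lookup-suc x xs κ) q))
  subsequence (suc j) {Q} (x ∷ xs) (suc i ∷ ι) inc q
    with κ , refl ← map-suc ι (λ l → ℕ.≤-trans (s≤s z≤n) (inc zero (suc l) (s≤s z≤n))) =
    inj₂ (subsequence (suc j) xs (i ∷ κ) (increasing-map-suc⁻ (i ∷ κ) inc)
      (subst Q (map-lookup-suc x xs (i ∷ κ)) q))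

OrderIsomorphic : Permutation j → Vec (Fin m) j → Set
OrderIsomorphic p ys = ∀ l r → (lookup ys l < lookup ys r) ⇔ (p at l < p at r)

contains⇔Subsequence : (w : Permutation m) (p : Permutation j) →
  Contains w p ⇔ Subsequence j (OrderIsomorphic p) (value w)
contains⇔Subsequence {j = j} w p = ⇔.trans
  (mk⇔ (λ (ι , inc , iso) → ι , inc , λ l r → subst₂ (iff l r) (sym (at ι l)) (sym (at ι r)) (iso l r))
       (λ (ι , inc , iso) → ι , inc , λ l r → subst₂ (iff l r) (at ι l) (at ι r) (iso l r)))
  (⇔.sym (Subsequence-positions j (value w)))
  where
  iff : ∀ l r → _ → _ → Set
  iff l r x y = (x < y) ⇔ (p at l < p at r)
  at : ∀ ι l → lookup (map (lookup (value w)) ι) l ≡ lookup (value w) (lookup ι l)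
  at ι l = Vec.lookup-map l (lookup (value w)) ι

letter : ∀ {n i} → i ℕ.< n → ∃ λ (a : Fin n) → toℕ a ≡ i
letter i<n = fromℕ< i<n , toℕ-fromℕ< i<n

permutation-size : {V : Code m → Set} {R : Permutation m → Set} {N : ℕ} →
  (∀ c → V c ⇔ R (Inverse.to code↔permutation c)) →
  HasSize [ c ∈ Code m ∣ V c ] N → HasSize [ w ∈ Permutation m ∣ R w ] N
permutation-size {V = V} {R} V⇔R = ↔-trans (mk↔ₛ′
  (λ (w , [ r ]) → decode w , [ from (V⇔R (decode w)) (subst R (sym (encode-decode w)) r) ])
  (λ (c , [ v ]) → encode c , [ to (V⇔R c) v ])
  (λ (c , _) → value-injective (Inverse.strictlyInverseʳ code↔permutation c))
  (λ (w , _) → value-injective (encode-decode w)))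
  where
  encode = Inverse.to code↔permutation
  decode = Inverse.from code↔permutation
  encode-decode = Inverse.strictlyInverseˡ code↔permutation

drop₂ : Code (2 + m) → Code m
drop₂ (_ ∷ _ ∷ u) = u

-- `zs` is `ys` in sorted order. Being strictly increasing, it reflects the order by trichotomy.
orderIsomorphic : ∀ (p : Permutation j) (ys : Vec (Fin m) j) (zs : Vec (Fin m) j) → Increasing zs →
  (∀ l → lookup ys l ≡ lookup zs (p at l)) → OrderIsomorphic p ys
orderIsomorphic p ys zs inc ys≡ l r = mk⇔
  (λ lt → reflects (p at l) (p at r) (subst₂ _<_ (ys≡ l) (ys≡ r) lt))
  (λ lt → subst₂ _<_ (sym (ys≡ l)) (sym (ys≡ r)) (inc (p at l) (p at r) lt))
  where
  reflects : ∀ a b → lookup zs a < lookup zs b → a < b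
  reflects a b lt with <-cmp a b
  ... | tri< a<b _ _    = a<b
  ... | tri≈ _ refl _   = ⊥-elim (ℕ.<-irrefl refl lt)
  ... | tri> _ _ b<a    = ⊥-elim (ℕ.<-asym lt (inc b a b<a))

-- Inserting a letter at site v turns the site s of the longer word into the site pin v s of the
-- shorter one.
pin : ℕ → ℕ → ℕ
pin v       zero    = zero
pin zero    (suc s) = s
pin (suc v) (suc s) = suc (pin v s)

pin-≤ : ∀ v s → s ≤ v → pin v s ≡ s
pin-≤ v       zero    _         = refl
pin-≤ (suc v) (suc s) (s≤s s≤v) = cong suc (pin-≤ v s s≤v)

pin-> : ∀ v s → v ≤ s → pin v (suc s) ≡ s
pin-> zero    s       _         = refl
pin-> (suc v) (suc s) (s≤s v≤s) = cong suc (pin-> v s v≤s)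

-- `pin v` is the lower adjoint of `punchIn v`; it merges the sites v and v + 1 on either side of
-- the inserted letter. Through this adjunction every bound on letters is carried to the shorter
-- word.
≤-punchIn : ∀ (v : Fin (suc m)) s (x : Fin m) → s ≤ toℕ (punchIn v x) ⇔ pin (toℕ v) s ≤ toℕ x
≤-punchIn v       zero    x       = mk⇔ (λ _ → z≤n) (λ _ → z≤n)
≤-punchIn zero    (suc s) x       = mk⇔ s≤s⁻¹ s≤s
≤-punchIn (suc v) (suc s) zero    = mk⇔ (λ ()) (λ ())
≤-punchIn (suc v) (suc s) (suc x) = mk⇔ (λ le → s≤s (to (≤-punchIn v s x) (s≤s⁻¹ le)))
                                        (λ le → s≤s (from (≤-punchIn v s x) (s≤s⁻¹ le)))

pin-punchIn : ∀ (v : Fin (suc m)) x → pin (toℕ v) (suc (toℕ (punchIn v x))) ≡ suc (toℕ x)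
pin-punchIn zero    x       = refl
pin-punchIn (suc v) zero    = refl
pin-punchIn (suc v) (suc x) = cong suc (pin-punchIn v x)

<-punchIn : ∀ (v : Fin (suc m)) x l → toℕ (punchIn v x) ℕ.< l ⇔ toℕ x ℕ.< pin (toℕ v) l
<-punchIn v x l = mk⇔
  (λ lt → ℕ.≰⇒> (λ le → ℕ.<⇒≱ lt (from (≤-punchIn v l x) le)))
  (λ lt → ℕ.≰⇒> (λ le → ℕ.<⇒≱ lt (to (≤-punchIn v l x) le)))

punchIn-<⇔ : ∀ (v : Fin (suc m)) x y → punchIn v x < punchIn v y ⇔ x < y
punchIn-<⇔ v x y = subst (λ s → punchIn v x < punchIn v y ⇔ s ≤ toℕ y) (pin-punchIn v x) (≤-punchIn v (suc (toℕ (punchIn v x))) y)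

<-punchIn-self : ∀ (v : Fin (suc m)) x → v < punchIn v x ⇔ toℕ v ≤ toℕ x
<-punchIn-self v x = subst (λ s → v < punchIn v x ⇔ s ≤ toℕ x) (pin-> (toℕ v) (toℕ v) ℕ.≤-refl) (≤-punchIn v (suc (toℕ v)) x)

punchIn-<-self : ∀ (v : Fin (suc m)) x → punchIn v x < v ⇔ toℕ x ℕ.< toℕ v
punchIn-<-self v x = subst (λ s → punchIn v x < v ⇔ toℕ x ℕ.< s) (pin-≤ (toℕ v) (toℕ v) ℕ.≤-refl) (<-punchIn v x (toℕ v))

-- The up-down condition on codes

AlternatingWord : Vec (Fin k) m → Set
AlternatingWord {m = m} xs = ∀ (i j : Fin m) → toℕ j ≡ suc (toℕ i) →
  (2 ∣ toℕ i → lookup xs i < lookup xs j) × (2 ∤ toℕ i → lookup xs i > lookup xs j)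

HeadBelow : Fin k → Vec (Fin k) m → Set
HeadBelow y []      = ⊤
HeadBelow y (z ∷ _) = z < y

-- Taking letters two at a time removes the parity of positions and fits the growth by pairs.
UpDown : Vec (Fin k) m → Set
UpDown []           = ⊤
UpDown (x ∷ [])     = ⊤
UpDown (x ∷ y ∷ xs) = (x < y × HeadBelow y xs) × UpDown xs

private
  2∣2+ : ∀ {i} → 2 ∣ i ⇔ 2 ∣ 2 + i
  2∣2+ = mk⇔ (∣m∣n⇒∣m+n ∣-refl) (λ d → ∣m+n∣m⇒∣n d ∣-refl)

  2∤1 : 2 ∤ 1
  2∤1 d with () ← ∣1⇒≡1 d

alternating⇒upDown : (xs : Vec (Fin k) m) → AlternatingWord xs → UpDown xs
alternating⇒upDown []           alt = tt
alternating⇒upDown (x ∷ [])     alt = tt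
alternating⇒upDown (x ∷ y ∷ xs) alt =
  (proj₁ (alt zero (suc zero) refl) (2 ∣0) , headBelow xs alt) ,
  alternating⇒upDown xs λ i j eq →
    let up , down = alt (suc (suc i)) (suc (suc j)) (cong (λ i → 2 + i) eq)
    in (λ d → up (to 2∣2+ d)) , (λ nd → down (λ d → nd (from 2∣2+ d)))
  where
  headBelow : ∀ {m} (xs : Vec _ m) → AlternatingWord (x ∷ y ∷ xs) → HeadBelow y xs
  headBelow []       _   = tt
  headBelow (z ∷ xs) alt = proj₂ (alt (suc zero) (suc (suc zero)) refl) 2∤1

upDown⇒alternating : (xs : Vec (Fin k) m) → UpDown xs → AlternatingWord xs
upDown⇒alternating (x ∷ []) _ zero zero ()
upDown⇒alternating (x ∷ y ∷ xs) ((x<y , _) , _) zero (suc zero) _ =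
  (λ _ → x<y) , (λ nd → ⊥-elim (nd (2 ∣0)))
upDown⇒alternating (x ∷ y ∷ z ∷ xs) ((_ , z<y) , _) (suc zero) (suc (suc zero)) _ =
  (λ d → ⊥-elim (2∤1 d)) , (λ _ → z<y)
upDown⇒alternating (x ∷ y ∷ xs) (_ , ud) (suc (suc i)) (suc (suc j)) eq =
  let up , down = upDown⇒alternating xs ud i j (ℕ.suc-injective (ℕ.suc-injective eq))
  in (λ d → up (from 2∣2+ d)) , (λ nd → down (λ d → nd (to 2∣2+ d)))

upDown-punchIn : ∀ (v : Fin (suc k)) (xs : Vec (Fin k) m) → UpDown (map (punchIn v) xs) ⇔ UpDown xs
upDown-punchIn v []           = ⇔.refl
upDown-punchIn v (x ∷ [])     = ⇔.refl
upDown-punchIn v (x ∷ y ∷ xs) = (punchIn-<⇔ v x y ×-⇔ headBelow xs) ×-⇔ upDown-punchIn v xs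
  where
  headBelow : ∀ {m} (xs : Vec _ m) → HeadBelow (punchIn v y) (map (punchIn v) xs) ⇔ HeadBelow y xs
  headBelow []       = ⇔.refl
  headBelow (z ∷ xs) = punchIn-<⇔ v z y

-- A site s lies above the first letter iff first c ≤ s.
first : Code m → ℕ
first []      = 0
first (h ∷ _) = suc (toℕ h)

UpDownCode : ∀ n → Code (n * 2) → Set
UpDownCode zero    []          = ⊤
UpDownCode (suc n) (c ∷ d ∷ u) = (toℕ c ≤ toℕ d × first u ≤ toℕ d) × UpDownCode n u

upDown-word : ∀ n (c : Code (n * 2)) → UpDown (word c) ⇔ UpDownCode n c
upDown-word zero    []          = ⇔.refl
upDown-word (suc n) (c ∷ d ∷ u) =
  (<-punchIn-self c d ×-⇔ headBelow u) ×-⇔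
  ⇔.trans (upDown-punchIn c _) (⇔.trans (upDown-punchIn d (word u)) (upDown-word n u))
  where
  headBelow : ∀ {m} {c : Fin (suc (suc m))} {d : Fin (suc m)} (u : Code m) →
    HeadBelow (punchIn c d) (map (punchIn c) (map (punchIn d) (word u))) ⇔ first u ≤ toℕ d
  headBelow []      = mk⇔ (λ _ → z≤n) (λ _ → tt)
  headBelow {c = c} {d} (h ∷ u) = ⇔.trans (punchIn-<⇔ c (punchIn d h) d) (punchIn-<-self d h)

alternating⇔upDownCode : ∀ n (c : Code (n * 2)) →
  UpDownCode n c ⇔ Alternating (Inverse.to code↔permutation c)
alternating⇔upDownCode n c = ⇔.trans (⇔.sym (upDown-word n c))
  (mk⇔ (upDown⇒alternating (word c)) (alternating⇒upDown (word c)))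

≤-pin : ∀ v s → s ≤ suc (pin v s)
≤-pin v       zero    = z≤n
≤-pin zero    (suc s) = ℕ.≤-refl
≤-pin (suc v) (suc s) = s≤s (≤-pin v s)

-- The threshold p of the shorter word as a threshold of the word with a letter inserted at site v.
shift : ℕ → ℕ → ℕ
shift v       zero    = zero
shift zero    (suc p) = suc (suc p)
shift (suc v) (suc p) = suc (shift v p)

-- `pin v` is monotone, so the preimage of an initial segment of length `p` is again an initial
-- segment; `shift v p` is its length.
<-shift : ∀ v s p → s ℕ.< shift v p ⇔ pin v s ℕ.< p
<-shift v       s       zero    = mk⇔ (λ ()) (λ ())
<-shift zero    zero    (suc p) = mk⇔ (λ _ → s≤s z≤n) (λ _ → s≤s z≤n)
<-shift zero    (suc s) (suc p) = mk⇔ s≤s⁻¹ s≤s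
<-shift (suc v) zero    (suc p) = mk⇔ (λ _ → s≤s z≤n) (λ _ → s≤s z≤n)
<-shift (suc v) (suc s) (suc p) = mk⇔ (λ lt → s≤s (to (<-shift v s p) (s≤s⁻¹ lt)))
                                      (λ lt → s≤s (from (<-shift v s p) (s≤s⁻¹ lt)))

shift-≤ : ∀ v p → p ≤ v → shift v p ≡ p
shift-≤ v       zero    _         = refl
shift-≤ (suc v) (suc p) (s≤s p≤v) = cong suc (shift-≤ v p p≤v)

shift-> : ∀ v p → v ℕ.< p → shift v p ≡ suc p
shift-> zero    (suc p) _         = refl
shift-> (suc v) (suc p) (s≤s v<p) = cong suc (shift-> v p v<p)

≤-shift : ∀ v p → p ≤ shift v p
≤-shift v       zero    = z≤n
≤-shift zero    (suc p) = ℕ.n≤1+n _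
≤-shift (suc v) (suc p) = s≤s (≤-shift v p)

<-⊔ : ∀ s x y → s ℕ.< x ⊔ y ⇔ (s ℕ.< x ⊎ s ℕ.< y)
<-⊔ s x y = mk⇔
  (λ lt → [ (λ eq → inj₁ (subst (s ℕ.<_) eq lt)) , (λ eq → inj₂ (subst (s ℕ.<_) eq lt)) ]′ (ℕ.⊔-sel x y))
  [ (λ lt → ℕ.<-≤-trans lt (ℕ.m≤m⊔n x y)) , (λ lt → ℕ.<-≤-trans lt (ℕ.m≤n⊔m x y)) ]′

-- Avoiding 1234

Up : ℕ → Vec (Fin k) j → Set
Up s []       = ⊤
Up s (y ∷ ys) = s ≤ toℕ y × Up (suc (toℕ y)) ys

up-punchIn : ∀ (v : Fin (suc k)) s (ys : Vec (Fin k) j) → Up s (map (punchIn v) ys) ⇔ Up (pin (toℕ v) s) ys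
up-punchIn v s []       = ⇔.refl
up-punchIn v s (y ∷ ys) = ≤-punchIn v s y ×-⇔
  subst (λ t → Up (suc (toℕ (punchIn v y))) (map (punchIn v) ys) ⇔ Up t ys) (pin-punchIn v y)
    (up-punchIn v (suc (toℕ (punchIn v y))) ys)

up-increasing : ∀ {s} (zs : Vec (Fin k) j) → Up s zs → Increasing zs
up-increasing (z ∷ zs) (_ , up) zero    (suc r) _         = bounded zs up r
  where
  bounded : ∀ {k j s} (zs : Vec (Fin k) j) → Up s zs → ∀ r → s ≤ toℕ (lookup zs r)
  bounded (z ∷ zs) (s≤z , _)  zero    = s≤z
  bounded (z ∷ zs) (s≤z , up) (suc r) = ℕ.<⇒≤ (ℕ.≤-<-trans s≤z (bounded zs up r))
up-increasing (z ∷ zs) (_ , up) (suc l) (suc r) (s≤s l<r) = up-increasing zs up l r l<r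

iso-1234 : (ys : Vec (Fin m) 4) → OrderIsomorphic [1234] ys ⇔ Up 0 ys
iso-1234 (a ∷ b ∷ c ∷ d ∷ []) = mk⇔
  (λ iso → z≤n , from (iso 0F 1F) ℕ.≤-refl , from (iso 1F 2F) ℕ.≤-refl , from (iso 2F 3F) ℕ.≤-refl , tt)
  (λ up → orderIsomorphic [1234] (a ∷ b ∷ c ∷ d ∷ []) (a ∷ b ∷ c ∷ d ∷ []) (up-increasing _ up)
    λ { 0F → refl ; 1F → refl ; 2F → refl ; 3F → refl })

-- In the first summand the next letter must exceed v; the site v + 1 just above v becomes the site
-- v of the remaining word, whence `Up (toℕ v)`.
rising-∷ : ∀ j (v : Fin (suc m)) (c : Code m) s → Subsequence (suc j) (Up s) (word (v ∷ c)) ⇔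
  ((s ≤ toℕ v × Subsequence j (Up (toℕ v)) (word c)) ⊎ Subsequence (suc j) (Up (pin (toℕ v) s)) (word c))
rising-∷ j v c s =
  ⇔.trans (Subsequence-× j _) (⇔.refl ×-⇔
    subst (λ t → Subsequence j (Up (suc (toℕ v))) (map (punchIn v) (word c)) ⇔ Subsequence j (Up t) (word c))
      (pin-> (toℕ v) (toℕ v) ℕ.≤-refl) (shorter j (suc (toℕ v))))
  ⊎-⇔ shorter (suc j) s
  where
  shorter : ∀ j s → Subsequence j (Up s) (map (punchIn v) (word c)) ⇔ Subsequence j (Up (pin (toℕ v) s)) (word c)
  shorter j s = ⇔.trans (Subsequence-map (punchIn v) j (word c)) (Subsequence-cong j (up-punchIn v s) (word c))

-- The contribution of sequences starting at the new letter v: if v lies below a shorter rising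
-- sequence, all sites up to v count. Otherwise 0, the neutral element of `⊔`.
raise : ℕ → ℕ → ℕ
raise v t with v ℕ.<? t
... | yes _ = suc v
... | no  _ = 0

raise-< : ∀ {v t} → v ℕ.< t → raise v t ≡ suc v
raise-< {v} {t} v<t with v ℕ.<? t
... | yes _  = refl
... | no v≮t = ⊥-elim (v≮t v<t)

raise-≥ : ∀ {v t} → t ≤ v → raise v t ≡ 0
raise-≥ {v} {t} t≤v with v ℕ.<? t
... | yes v<t = ⊥-elim (ℕ.<⇒≱ v<t t≤v)
... | no  _   = refl

<-raise : ∀ s v t → s ℕ.< raise v t ⇔ (s ≤ v × v ℕ.< t)
<-raise s v t with v ℕ.<? t
... | yes v<t = mk⇔ (λ lt → s≤s⁻¹ lt , v<t) (λ (le , _) → s≤s le)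
... | no v≮t  = mk⇔ (λ ()) (λ (_ , v<t) → ⊥-elim (v≮t v<t))

-- The sites below some rising sequence of `j + 1` letters form an initial segment, and this is its
-- length. So p is `threshold 1` and q is `threshold 2`, while `threshold 0` counts all sites but
-- the top one.
threshold : ℕ → Code m → ℕ
threshold _       []          = 0
threshold zero    (_∷_ {m} v c) = suc m
threshold (suc j) (v ∷ c)     = raise (toℕ v) (threshold j c) ⊔ shift (toℕ v) (threshold (suc j) c)

threshold-zero : (c : Code m) → threshold 0 c ≡ m
threshold-zero []      = refl
threshold-zero (_ ∷ _) = refl

<-threshold : ∀ j (c : Code m) s → Subsequence (suc j) (Up s) (word c) ⇔ s ℕ.< threshold j c
<-threshold j [] s = mk⇔ (λ ()) (λ ())
<-threshold zero (_∷_ {m} v c) s = ⇔.trans (rising-∷ 0 v c s) (mk⇔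
  [ (λ (s≤v , _) → s≤s (ℕ.≤-trans s≤v (s≤s⁻¹ (toℕ<n v)))) , (λ sub → ℕ.≤-<-trans (≤-pin (toℕ v) s) (s≤s (to IH sub))) ]′
  (λ s<1+m → below s (s ℕ.≤? toℕ v) s<1+m))
  where
  IH : ∀ {s} → Subsequence 1 (Up s) (word c) ⇔ s ℕ.< m
  IH {s} = subst (λ t → Subsequence 1 (Up s) (word c) ⇔ s ℕ.< t) (threshold-zero c) (<-threshold 0 c s)
  below : ∀ s → Dec (s ≤ toℕ v) → s ℕ.< suc m → (s ≤ toℕ v × ⊤) ⊎ Subsequence 1 (Up (pin (toℕ v) s)) (word c)
  below s       (yes s≤v) _         = inj₁ (s≤v , tt)
  below zero    (no s≰v)  _         = ⊥-elim (s≰v z≤n)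
  below (suc s) (no s≰v)  (s≤s s<m) =
    inj₂ (from IH (subst (ℕ._< m) (sym (pin-> (toℕ v) s (s≤s⁻¹ (ℕ.≰⇒> s≰v)))) s<m))
<-threshold (suc j) (v ∷ c) s = ⇔.trans (rising-∷ (suc j) v c s) (⇔.trans
  (⇔.trans (⇔.refl ×-⇔ <-threshold j c (toℕ v)) (⇔.sym (<-raise s (toℕ v) (threshold j c)))
   ⊎-⇔ ⇔.trans (<-threshold (suc j) c (pin (toℕ v) s)) (⇔.sym (<-shift (toℕ v) s (threshold (suc j) c))))
  (⇔.sym (<-⊔ s _ _)))

Avoids1234 : Code m → Set
Avoids1234 c = ¬ Subsequence 4 (Up 0) (word c)

avoids-1234-∷ : ∀ (v : Fin (suc m)) (c : Code m) →
  Avoids1234 (v ∷ c) ⇔ (threshold 2 c ≤ toℕ v × Avoids1234 c)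
avoids-1234-∷ v c = mk⇔
  (λ av → ℕ.≮⇒≥ (λ lt → av (from sub (inj₁ (z≤n , from (<-threshold 2 c (toℕ v)) lt)))) ,
          (λ s → av (from sub (inj₂ s))))
  (λ (le , av) s → [ (λ (_ , r) → ℕ.<⇒≱ (to (<-threshold 2 c (toℕ v)) r) le) , av ]′ (to sub s))
  where sub = rising-∷ 3 v c 0

Valid-1234 : ∀ n → Code (n * 2) → Set
Valid-1234 zero    []          = ⊤
Valid-1234 (suc n) (c ∷ d ∷ u) =
  Valid-1234 n u × threshold 1 u ≤ toℕ d × threshold 2 u ≤ toℕ c × toℕ c ≤ toℕ d

valid-1234? : ∀ n (c : Code (n * 2)) → Dec (Valid-1234 n c)
valid-1234? zero    []          = yes tt
valid-1234? (suc n) (c ∷ d ∷ u) =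
  valid-1234? n u ×-dec threshold 1 u ℕ.≤? toℕ d ×-dec threshold 2 u ℕ.≤? toℕ c ×-dec toℕ c ℕ.≤? toℕ d

-- The first letter of a nonempty up-down word begins a 12. Thus p ≤ d already yields the descent
-- from the second letter to the third.
first≤threshold : ∀ n (u : Code (n * 2)) → UpDownCode n u → first u ≤ threshold 1 u
first≤threshold zero    []          _  = z≤n
first≤threshold (suc n) (c ∷ d ∷ u) ud =
  ℕ.≤-trans (ℕ.≤-reflexive (sym (raise-< (s≤s (ℕ.≤-trans (proj₁ (proj₁ ud)) (s≤s⁻¹ (toℕ<n d)))))))
    (ℕ.m≤m⊔n _ _)

-- As c < d, a 12 of `u` above d would complete a 1234, whence p ≤ d. Then d begins no 123, so the
-- sites forbidden for c are those of `u`, and q ≤ c ≤ d also clears d.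
valid-1234⇔ : ∀ n (c : Code (n * 2)) → Valid-1234 n c ⇔ (UpDownCode n c × Avoids1234 c)
valid-1234⇔ zero    []          = mk⇔ (λ _ → tt , λ ()) (λ _ → tt)
valid-1234⇔ (suc n) (c ∷ d ∷ u) = mk⇔
  (λ (v , p≤d , q≤c , c≤d) →
    let ud , av = to (valid-1234⇔ n u) v
    in ((c≤d , ℕ.≤-trans (first≤threshold n u ud) p≤d) , ud) ,
       from (avoids-1234-∷ c (d ∷ u))
         ( ℕ.⊔-lub (ℕ.≤-trans (ℕ.≤-reflexive (raise-≥ p≤d)) z≤n)
             (ℕ.≤-trans (ℕ.≤-reflexive (shift-≤ (toℕ d) _ (ℕ.≤-trans q≤c c≤d))) q≤c)
         , from (avoids-1234-∷ d u) (ℕ.≤-trans q≤c c≤d , av) ))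
  (λ (((c≤d , _) , ud) , av) →
    let q′≤c , av′ = to (avoids-1234-∷ c (d ∷ u)) av
        _ , av″ = to (avoids-1234-∷ d u) av′
    in from (valid-1234⇔ n u) (ud , av″) ,
       ℕ.≮⇒≥ (λ d<p → ℕ.<⇒≱ (s≤s c≤d) (ℕ.≤-trans (ℕ.≤-reflexive (sym (raise-< d<p))) (ℕ.m⊔n≤o⇒m≤o _ _ q′≤c))) ,
       ℕ.≤-trans (≤-shift (toℕ d) _) (ℕ.m⊔n≤o⇒n≤o _ _ q′≤c) ,
       c≤d)

-- How the thresholds p, q of a code of length m change when letters are inserted at sites c ≤ d.
data Step (m p q c d : ℕ) : ℕ → ℕ → Set where
  low  : d ℕ.< m → Step m p q c d (2 + d) (suc c)
  high : d ≡ m → c ℕ.< p → Step m p q c d (suc p) (suc c)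
  top  : d ≡ m → p ≤ c → Step m p q c d (suc c) q

module _ (c : Fin (2 + m)) (d : Fin (1 + m)) (u : Code m)
         (p≤d : threshold 1 u ≤ toℕ d) (q≤c : threshold 2 u ≤ toℕ c) (c≤d : toℕ c ≤ toℕ d) where

  private
    p q : ℕ
    p = threshold 1 u
    q = threshold 2 u

    q-d : threshold 2 (d ∷ u) ≡ q
    q-d = cong₂ _⊔_ (raise-≥ p≤d) (shift-≤ (toℕ d) q (ℕ.≤-trans q≤c c≤d))

    p-c : threshold 1 (c ∷ d ∷ u) ≡ suc (toℕ c) ⊔ shift (toℕ c) (threshold 1 (d ∷ u))
    p-c = cong (_⊔ shift (toℕ c) (threshold 1 (d ∷ u))) (raise-< (s≤s (ℕ.≤-trans c≤d (s≤s⁻¹ (toℕ<n d)))))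

    q-c : threshold 2 (c ∷ d ∷ u) ≡ raise (toℕ c) (threshold 1 (d ∷ u)) ⊔ q
    q-c = cong (raise (toℕ c) (threshold 1 (d ∷ u)) ⊔_)
      (trans (cong (shift (toℕ c)) q-d) (shift-≤ (toℕ c) q q≤c))

    q-c-below : toℕ c ℕ.< threshold 1 (d ∷ u) → threshold 2 (c ∷ d ∷ u) ≡ suc (toℕ c)
    q-c-below c<p = trans q-c (trans (cong (_⊔ q) (raise-< c<p)) (ℕ.m≥n⇒m⊔n≡m (ℕ.m≤n⇒m≤1+n q≤c)))

    p-d-low : toℕ d ℕ.< m → threshold 1 (d ∷ u) ≡ suc (toℕ d)
    p-d-low d<m = trans
      (cong₂ _⊔_ (raise-< (subst (toℕ d ℕ.<_) (sym (threshold-zero u)) d<m)) (shift-≤ (toℕ d) p p≤d))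
      (ℕ.m≥n⇒m⊔n≡m (ℕ.m≤n⇒m≤1+n p≤d))

    p-d-top : toℕ d ≡ m → threshold 1 (d ∷ u) ≡ p
    p-d-top d≡m = cong₂ _⊔_
      (raise-≥ (ℕ.≤-reflexive (trans (threshold-zero u) (sym d≡m)))) (shift-≤ (toℕ d) p p≤d)

    Labels : ℕ → ℕ → Set
    Labels p′ q′ = threshold 1 (c ∷ d ∷ u) ≡ p′ × threshold 2 (c ∷ d ∷ u) ≡ q′

  -- In case `low` some letter of `u` exceeds d, so d begins a 12 and c begins a 123 through d; the
  -- insertion of c lifts d to d + 1, whence the label d + 2. If d is the top site, it begins no 12,
  -- and c begins a 123 exactly when c < p.
  step-labels : ∀ {p′ q′} → Step m p q (toℕ c) (toℕ d) p′ q′ → Labels p′ q′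
  step-labels (low d<m) =
    trans p-c (trans (cong (suc (toℕ c) ⊔_)
      (trans (cong (shift (toℕ c)) (p-d-low d<m)) (shift-> (toℕ c) _ (s≤s c≤d))))
      (ℕ.m≤n⇒m⊔n≡n (s≤s (ℕ.m≤n⇒m≤1+n c≤d)))) ,
    q-c-below (subst (toℕ c ℕ.<_) (sym (p-d-low d<m)) (s≤s c≤d))
  step-labels (high d≡m c<p) =
    trans p-c (trans (cong (suc (toℕ c) ⊔_)
      (trans (cong (shift (toℕ c)) (p-d-top d≡m)) (shift-> (toℕ c) p c<p)))
      (ℕ.m≤n⇒m⊔n≡n (ℕ.m≤n⇒m≤1+n c<p))) ,
    q-c-below (subst (toℕ c ℕ.<_) (sym (p-d-top d≡m)) c<p)
  step-labels (top d≡m p≤c) =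
    trans p-c (trans (cong (suc (toℕ c) ⊔_)
      (trans (cong (shift (toℕ c)) (p-d-top d≡m)) (shift-≤ (toℕ c) p p≤c)))
      (ℕ.m≥n⇒m⊔n≡m (ℕ.m≤n⇒m≤1+n p≤c))) ,
    trans q-c (cong (_⊔ q) (raise-≥ (ℕ.≤-trans (ℕ.≤-reflexive (p-d-top d≡m)) p≤c)))

  private
    relabel : ∀ {p′ q′} → Step m p q (toℕ c) (toℕ d) p′ q′ →
      Step m p q (toℕ c) (toℕ d) (threshold 1 (c ∷ d ∷ u)) (threshold 2 (c ∷ d ∷ u))
    relabel s with refl , refl ← step-labels s = s

  step : Step m p q (toℕ c) (toℕ d) (threshold 1 (c ∷ d ∷ u)) (threshold 2 (c ∷ d ∷ u))
  step with toℕ d ℕ.<? m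
  ... | yes d<m = relabel (low d<m)
  ... | no d≮m with toℕ c ℕ.<? p | ℕ.≤-antisym (s≤s⁻¹ (toℕ<n d)) (ℕ.≮⇒≥ d≮m)
  ... | yes c<p | d≡m = relabel (high d≡m c<p)
  ... | no  c≮p | d≡m = relabel (top d≡m (ℕ.≮⇒≥ c≮p))

step-bounds : ∀ {m p q c d p′ q′} → p ≤ d → q ≤ c → c ≤ d → d ≤ m → Step m p q c d p′ q′ →
  p ℕ.< p′ × p′ ≤ suc m × q ≤ q′ × q′ ℕ.< p′
step-bounds p≤d q≤c c≤d d≤m (low d<m) = s≤s (ℕ.m≤n⇒m≤1+n p≤d) , s≤s d<m , ℕ.m≤n⇒m≤1+n q≤c , s≤s (s≤s c≤d)
step-bounds p≤d q≤c c≤d d≤m (high refl c<p) = ℕ.≤-refl , s≤s p≤d , ℕ.m≤n⇒m≤1+n q≤c , s≤s c<p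
step-bounds p≤d q≤c c≤d d≤m (top refl p≤c) = s≤s p≤c , s≤s c≤d , ℕ.≤-refl , s≤s q≤c

-- The labels reveal the case: only `top` leaves q unchanged, and p grows by exactly one in `high`
-- but by at least two in `low`. `step-surjective` makes the same tests.
step-injective : ∀ {m p q c d c′ d′ p′ q′} → p ≤ d → q ≤ c → p ≤ d′ → q ≤ c′ →
  Step m p q c d p′ q′ → Step m p q c′ d′ p′ q′ → c ≡ c′ × d ≡ d′
step-injective p≤d q≤c p≤d′ q≤c′ (low _) (low _) = refl , refl
step-injective p≤d q≤c p≤d′ q≤c′ (low _) (high _ _) = ⊥-elim (ℕ.<-irrefl refl p≤d)
step-injective p≤d q≤c p≤d′ q≤c′ (low _) (top _ _) = ⊥-elim (ℕ.<-irrefl refl q≤c)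
step-injective p≤d q≤c p≤d′ q≤c′ (high _ _) (low _) = ⊥-elim (ℕ.<-irrefl refl p≤d′)
step-injective p≤d q≤c p≤d′ q≤c′ (high eq _) (high eq′ _) = refl , trans eq (sym eq′)
step-injective p≤d q≤c p≤d′ q≤c′ (high _ _) (top _ _) = ⊥-elim (ℕ.<-irrefl refl q≤c)
step-injective p≤d q≤c p≤d′ q≤c′ (top _ _) (low _) = ⊥-elim (ℕ.<-irrefl refl q≤c′)
step-injective p≤d q≤c p≤d′ q≤c′ (top _ _) (high _ _) = ⊥-elim (ℕ.<-irrefl refl q≤c′)
step-injective p≤d q≤c p≤d′ q≤c′ (top eq _) (top eq′ _) = refl , trans eq (sym eq′)

step-surjective : ∀ {m p q p′ q′} → p ℕ.< p′ → p′ ≤ suc m → q ≤ q′ → q′ ℕ.< p′ →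
  ∃ λ c → ∃ λ d → (p ≤ d × q ≤ c × c ≤ d × d ≤ m) × Step m p q c d p′ q′
step-surjective {m} {p} {q} {suc p′} {q′} (s≤s p≤p′) (s≤s p′≤m) q≤q′ (s≤s q′≤p′) with ℕ.m≤n⇒m<n∨m≡n q≤q′
... | inj₂ refl = p′ , m , (ℕ.≤-trans p≤p′ p′≤m , q′≤p′ , p′≤m , ℕ.≤-refl) , top refl p≤p′
step-surjective {m} {p} {q} {suc p′} {suc c} (s≤s p≤p′) (s≤s p′≤m) q≤q′ (s≤s c<p′)
  | inj₁ (s≤s q≤c) with ℕ.m≤n⇒m<n∨m≡n p≤p′
... | inj₂ refl = c , m , (p′≤m , q≤c , ℕ.<⇒≤ (ℕ.<-≤-trans c<p′ p′≤m) , ℕ.≤-refl) , high refl c<p′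
... | inj₁ (s≤s {n = d} p≤d) = c , d , (p≤d , q≤c , s≤s⁻¹ c<p′ , ℕ.<⇒≤ p′≤m) , low p′≤m

tree-1234 : GeneratingTree (λ n → Code (n * 2)) (λ {n} → Valid-1234 n)
tree-1234 = record
  { valid?       = valid-1234? _
  ; p            = threshold 1
  ; q            = threshold 2
  ; root         = []
  ; root-valid   = tt
  ; root-unique  = λ { [] → refl }
  ; root-p       = refl
  ; root-q       = refl
  ; parent       = drop₂
  ; parent-valid = λ { {c = _ ∷ _ ∷ _} (v , _) → v }
  ; p-increases  = λ {_} {c} v → proj₁ (bounds c v)
  ; p-bounded    = λ {_} {c} v → proj₁ (proj₂ (bounds c v))
  ; q-monotone   = λ {_} {c} v → proj₁ (proj₂ (proj₂ (bounds c v)))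
  ; q<p          = λ {_} {c} v → proj₂ (proj₂ (proj₂ (bounds c v)))
  ; label-unique = λ {_} {c} {c′} → unique c c′
  ; child        = child
  }
  where
  bounds : ∀ {n} (c : Code (2 + n * 2)) → Valid-1234 (suc n) c →
    threshold 1 (drop₂ c) ℕ.< threshold 1 c × threshold 1 c ≤ suc (n * 2) ×
    threshold 2 (drop₂ c) ≤ threshold 2 c × threshold 2 c ℕ.< threshold 1 c
  bounds (c ∷ d ∷ u) (_ , p≤d , q≤c , c≤d) =
    step-bounds p≤d q≤c c≤d (s≤s⁻¹ (toℕ<n d)) (step c d u p≤d q≤c c≤d)

  unique : ∀ {n} (c c′ : Code (2 + n * 2)) → Valid-1234 (suc n) c → Valid-1234 (suc n) c′ →
    drop₂ c ≡ drop₂ c′ → threshold 1 c ≡ threshold 1 c′ → threshold 2 c ≡ threshold 2 c′ → c ≡ c′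
  unique (c ∷ d ∷ u) (c′ ∷ d′ ∷ u) (_ , p≤d , q≤c , c≤d) (_ , p≤d′ , q≤c′ , c≤d′) refl p≡ q≡ =
    let c≡ , d≡ = step-injective p≤d q≤c p≤d′ q≤c′ (step c d u p≤d q≤c c≤d)
          (subst₂ (Step _ _ _ _ _) (sym p≡) (sym q≡) (step c′ d′ u p≤d′ q≤c′ c≤d′))
    in cong₂ (λ c d → c ∷ d ∷ u) (toℕ-injective c≡) (toℕ-injective d≡)

  child : ∀ {n} {u : Code (n * 2)} {p′ q′} → Valid-1234 n u →
    threshold 1 u ℕ.< p′ → p′ ≤ suc (n * 2) → threshold 2 u ≤ q′ → q′ ℕ.< p′ →
    ∃ λ c → Valid-1234 (suc n) c × drop₂ c ≡ u × threshold 1 c ≡ p′ × threshold 2 c ≡ q′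
  child {u = u} v p<p′ p′≤ q≤q′ q′<p′
    with _ , _ , (p≤d , q≤c , c≤d , d≤m) , s ← step-surjective p<p′ p′≤ q≤q′ q′<p′
    with d , refl ← letter (s≤s d≤m)
    with c , refl ← letter (s≤s (ℕ.≤-trans c≤d (ℕ.m≤n⇒m≤1+n d≤m))) =
    c ∷ d ∷ u , (v , p≤d , q≤c , c≤d) , refl , step-labels c d u p≤d q≤c c≤d s

size-1234 : ∀ n → HasSize (A (n * 2) [1234]) (skew 0 0 0 n)
size-1234 n = permutation-size
  (λ c → ⇔.trans (valid-1234⇔ n c) (alternating⇔upDownCode n c ×-⇔
    ¬-cong-⇔ (⇔.sym (⇔.trans (contains⇔Subsequence (Inverse.to code↔permutation c) [1234]) (Subsequence-cong 4 iso-1234 (word c))))))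
  (GeneratingTree.size tree-1234 n)

-- Avoiding 2143

Descent : ℕ → Vec (Fin k) 2 → Set
Descent s (z ∷ y ∷ []) = s ≤ toℕ y × y < z

-- Two bounds, since the sites just below and just above the letter playing 2 differ until that
-- letter is removed; then both become its site.
Shape143 : ℕ → ℕ → Vec (Fin k) 3 → Set
Shape143 l s (x ∷ zy) = toℕ x ℕ.< l × Descent s zy

Shape2143 : Vec (Fin k) 4 → Set
Shape2143 (w ∷ xzy) = Shape143 (toℕ w) (suc (toℕ w)) xzy

iso-2143 : (ys : Vec (Fin m) 4) → OrderIsomorphic [2143] ys ⇔ Shape2143 ys
iso-2143 (b ∷ a ∷ d ∷ c ∷ []) = mk⇔
  (λ iso → from (iso 1F 0F) ℕ.≤-refl , from (iso 0F 3F) (s≤s (s≤s z≤n)) , from (iso 3F 2F) ℕ.≤-refl)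
  (λ (a<b , b<c , c<d) → orderIsomorphic [2143] (b ∷ a ∷ d ∷ c ∷ []) (a ∷ b ∷ c ∷ d ∷ [])
    (up-increasing {s = 0} (a ∷ b ∷ c ∷ d ∷ []) (z≤n , a<b , b<c , c<d , tt))
    λ { 0F → refl ; 1F → refl ; 2F → refl ; 3F → refl })

descent-punchIn : ∀ (v : Fin (suc k)) s ys → Descent s (map (punchIn v) ys) ⇔ Descent (pin (toℕ v) s) ys
descent-punchIn v s (z ∷ y ∷ []) = ≤-punchIn v s y ×-⇔ punchIn-<⇔ v y z

shape143-punchIn : ∀ (v : Fin (suc k)) l s ys →
  Shape143 l s (map (punchIn v) ys) ⇔ Shape143 (pin (toℕ v) l) (pin (toℕ v) s) ys
shape143-punchIn v l s (x ∷ zy) = <-punchIn v x l ×-⇔ descent-punchIn v s zy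

shape2143-punchIn : ∀ (v : Fin (suc k)) ys → Shape2143 (map (punchIn v) ys) ⇔ Shape2143 ys
shape2143-punchIn v (w ∷ x ∷ z ∷ y ∷ []) =
  punchIn-<⇔ v x w ×-⇔ punchIn-<⇔ v w y ×-⇔ punchIn-<⇔ v y z

-- The number of sites below the bottom of some 21. All v letters smaller than a first letter v come
-- after it, so its largest bottom is v - 1 and it contributes the sites below v.
descentBottoms : Code m → ℕ
descentBottoms []      = 0
descentBottoms (v ∷ c) = toℕ v ⊔ shift (toℕ v) (descentBottoms c)

<-descentBottoms : (c : Code m) → ∀ s → Subsequence 2 (Descent s) (word c) ⇔ s ℕ.< descentBottoms c
<-descentBottoms []      s = mk⇔ (λ ()) (λ ())
<-descentBottoms (v ∷ c) s = ⇔.trans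
  (⇔.trans (⇔.trans (Subsequence-map (punchIn v) 1 (word c)) (Subsequence-cong 1 (λ { (y ∷ []) → ≤-punchIn v s y ×-⇔ punchIn-<-self v y }) (word c)))
     between
   ⊎-⇔ ⇔.trans (⇔.trans (Subsequence-map (punchIn v) 2 (word c)) (Subsequence-cong 2 (descent-punchIn v s) (word c)))
         (⇔.trans (<-descentBottoms c (pin (toℕ v) s)) (⇔.sym (<-shift (toℕ v) s (descentBottoms c)))))
  (⇔.sym (<-⊔ s _ _))
  where
  Between : Vec (Fin _) 1 → Set
  Between (y ∷ []) = pin (toℕ v) s ≤ toℕ y × toℕ y ℕ.< toℕ v
  pin-< : ∀ v s → pin v s ℕ.< v → s ℕ.< v
  pin-< (suc v) zero    lt = lt
  pin-< (suc v) (suc s) lt = s≤s (pin-< v s (s≤s⁻¹ lt))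
  below : Subsequence 1 Between (word c) → s ℕ.< toℕ v
  below sub with (i ∷ []) , _ , s≤y , y<v ← to (Subsequence-positions 1 (word c)) sub =
    pin-< (toℕ v) s (ℕ.≤-<-trans s≤y y<v)
  predecessor : ∀ {t} → toℕ v ≡ t → s ℕ.< t → Subsequence 1 Between (word c)
  predecessor {suc t} v≡ (s≤s s≤t)
    with y , refl ← letter (subst (_≤ _) v≡ (s≤s⁻¹ (toℕ<n v)))
    with i , eq ← letter-occurs c y =
    from (Subsequence-positions 1 (word c)) (i ∷ [] , (λ { zero zero () }) ,
      subst₂ _≤_ (sym (pin-≤ (toℕ v) s (ℕ.≤-trans s≤t (ℕ.≤-trans (ℕ.n≤1+n _) (ℕ.≤-reflexive (sym v≡))))))
                 (sym (cong toℕ eq)) s≤t ,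
      subst₂ ℕ._<_ (sym (cong toℕ eq)) (sym v≡) ℕ.≤-refl)
  between : Subsequence 1 Between (word c) ⇔ s ℕ.< toℕ v
  between = mk⇔ below (predecessor refl)

-- The sites s at which an inserted letter would be the first letter of an occurrence of 2143.
Killed : Code m → ℕ → Set
Killed []      s = ⊥
Killed (v ∷ c) s = (toℕ v ℕ.< s × s ≤ descentBottoms c) ⊎ Killed c (pin (toℕ v) s)

killed? : (c : Code m) → Decidable (Killed c)
killed? []      s = no λ ()
killed? (v ∷ c) s = (toℕ v ℕ.<? s ×-dec s ℕ.≤? descentBottoms c) ⊎-dec killed? c (pin (toℕ v) s)

shape143⇔killed : (c : Code m) → ∀ s → Subsequence 3 (Shape143 s s) (word c) ⇔ Killed c s
shape143⇔killed []      s = ⇔.refl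
shape143⇔killed (v ∷ c) s =
  ⇔.trans (⇔.trans (Subsequence-× 2 {Q = Descent s} (map (punchIn v) (word c))) (⇔.refl ×-⇔ ⇔.trans
    (⇔.trans (Subsequence-map (punchIn v) 2 {Descent s} (word c)) (Subsequence-cong 2 (descent-punchIn v s) (word c)))
    (<-descentBottoms c (pin (toℕ v) s)))) (above (toℕ v) s)
  ⊎-⇔ ⇔.trans (⇔.trans (Subsequence-map (punchIn v) 3 (word c)) (Subsequence-cong 3 (shape143-punchIn v s s) (word c)))
        (shape143⇔killed c (pin (toℕ v) s))
  where
  above : ∀ v s {r} → (v ℕ.< s × pin v s ℕ.< r) ⇔ (v ℕ.< s × s ≤ r)
  above v zero    = mk⇔ (λ ()) (λ ())
  above v (suc s) {r} = mk⇔
    (λ (v<s , lt) → v<s , subst (ℕ._< r) (pin-> v s (s≤s⁻¹ v<s)) lt)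
    (λ (v<s , lt) → v<s , subst (ℕ._< r) (sym (pin-> v s (s≤s⁻¹ v<s))) lt)

Avoids2143 : Code m → Set
Avoids2143 c = ¬ Subsequence 4 Shape2143 (word c)

avoids-2143-∷ : ∀ (v : Fin (suc m)) (c : Code m) →
  Avoids2143 (v ∷ c) ⇔ (¬ Killed c (toℕ v) × Avoids2143 c)
avoids-2143-∷ v c = mk⇔
  (λ av → (λ k → av (inj₁ (from here k))) , (λ s → av (inj₂ (from there s))))
  (λ (¬k , av) → [ ¬k ∘ to here , av ∘ to there ]′)
  where
  here : Subsequence 3 (Shape143 (toℕ v) (suc (toℕ v))) (map (punchIn v) (word c)) ⇔ Killed c (toℕ v)
  here = ⇔.trans (⇔.trans (Subsequence-map (punchIn v) 3 (word c))
    (Subsequence-cong 3 (shape143-punchIn v (toℕ v) (suc (toℕ v))) (word c)))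
    (subst₂ (λ l s → Subsequence 3 (Shape143 l s) (word c) ⇔ Killed c (toℕ v))
      (sym (pin-≤ (toℕ v) (toℕ v) ℕ.≤-refl)) (sym (pin-> (toℕ v) (toℕ v) ℕ.≤-refl))
      (shape143⇔killed c (toℕ v)))
  there : Subsequence 4 Shape2143 (map (punchIn v) (word c)) ⇔ Subsequence 4 Shape2143 (word c)
  there = ⇔.trans (Subsequence-map (punchIn v) 4 (word c)) (Subsequence-cong 4 (shape2143-punchIn v) (word c))

-- The 3 of the 143 is a descent bottom above the site.
killed⇒<descentBottoms : ∀ (c : Code m) {s} → Killed c s → s ℕ.< descentBottoms c
killed⇒<descentBottoms (v ∷ c) {s} (inj₁ (v<s , s≤r)) =
  from (<-⊔ s _ _) (inj₂ (subst (s ℕ.<_) (sym (shift-> (toℕ v) _ (ℕ.<-≤-trans v<s s≤r))) (s≤s s≤r)))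
killed⇒<descentBottoms (v ∷ c) {s} (inj₂ k) =
  from (<-⊔ s _ _) (inj₂ (from (<-shift (toℕ v) s _) (killed⇒<descentBottoms c k)))

-- For a site above the first letter, that letter can play the 1. Alternation puts d there, so for d
-- the killed sites reduce to a single threshold.
killed-by-first : ∀ (c : Code m) {s} → first c ≤ s → s ℕ.< descentBottoms c → Killed c s
killed-by-first (h ∷ c) {suc s} h<s lt with to (<-⊔ (suc s) _ _) lt
... | inj₁ s<h     = ⊥-elim (ℕ.<-asym h<s s<h)
... | inj₂ s<shift = inj₁ (h<s , subst (ℕ._< descentBottoms c) (pin-> (toℕ h) s (s≤s⁻¹ h<s)) (to (<-shift (toℕ h) (suc s) _) s<shift))

descentThreshold : Code m → ℕ
descentThreshold c = descentBottoms c ⊔ first c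

Valid-2143 : ∀ n → Code (n * 2) → Set
Valid-2143 zero    []          = ⊤
Valid-2143 (suc n) (c ∷ d ∷ u) =
  Valid-2143 n u × descentThreshold u ≤ toℕ d × ¬ Killed u (toℕ c) × toℕ c ≤ toℕ d

valid-2143? : ∀ n (c : Code (n * 2)) → Dec (Valid-2143 n c)
valid-2143? zero    []          = yes tt
valid-2143? (suc n) (c ∷ d ∷ u) =
  valid-2143? n u ×-dec descentThreshold u ℕ.≤? toℕ d ×-dec ¬? (killed? u (toℕ c)) ×-dec toℕ c ℕ.≤? toℕ d

valid-2143⇔ : ∀ n (c : Code (n * 2)) → Valid-2143 n c ⇔ (UpDownCode n c × Avoids2143 c)
valid-2143⇔ zero    []          = mk⇔ (λ _ → tt , λ ()) (λ _ → tt)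
valid-2143⇔ (suc n) (c ∷ d ∷ u) = mk⇔
  (λ (v , p≤d , alive , c≤d) →
    let ud , av = to (valid-2143⇔ n u) v
    in ((c≤d , ℕ.m⊔n≤o⇒n≤o _ _ p≤d) , ud) ,
       from (avoids-2143-∷ c (d ∷ u))
         -- The letter d exceeds c and cannot play the 1 below it, so c is constrained by `u` alone.
         ( [ (λ (d<c , _) → ℕ.<⇒≱ d<c c≤d) , (λ k → alive (subst (Killed u) (pin-≤ _ _ c≤d) k)) ]′
         , from (avoids-2143-∷ d u)
             ((λ k → ℕ.<⇒≱ (killed⇒<descentBottoms u k) (ℕ.m⊔n≤o⇒m≤o _ _ p≤d)) , av) ))
  (λ (((c≤d , first≤d) , ud) , av) →
    let ¬k′ , av′ = to (avoids-2143-∷ c (d ∷ u)) av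
        ¬k″ , av″ = to (avoids-2143-∷ d u) av′
    in from (valid-2143⇔ n u) (ud , av″) ,
       ℕ.⊔-lub (ℕ.≮⇒≥ (λ d<r → ¬k″ (killed-by-first u first≤d d<r))) first≤d ,
       (λ k → ¬k′ (inj₂ (subst (Killed u) (sym (pin-≤ _ _ c≤d)) k))) ,
       c≤d)

-- Counting and selecting sites

module _ {P : ℕ → Set} (P? : Decidable P) where

  count : ℕ → ℕ
  count zero    = 0
  count (suc n) with P? n
  ... | yes _ = suc (count n)
  ... | no  _ = count n

  count-yes : ∀ {n} → P n → count (suc n) ≡ suc (count n)
  count-yes {n} Pn with P? n
  ... | yes _  = refl
  ... | no ¬Pn = ⊥-elim (¬Pn Pn)

  count-no : ∀ {n} → ¬ P n → count (suc n) ≡ count n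
  count-no {n} ¬Pn with P? n
  ... | yes Pn = ⊥-elim (¬Pn Pn)
  ... | no _   = refl

  count-+ : ∀ n i → count (n + i) ≤ count n + i
  count-+ n zero    = ℕ.≤-reflexive (trans (cong count (ℕ.+-identityʳ n)) (sym (ℕ.+-identityʳ _)))
  count-+ n (suc i) rewrite ℕ.+-suc n i | ℕ.+-suc (count n) i with P? (n + i)
  ... | yes _ = s≤s (count-+ n i)
  ... | no  _ = ℕ.m≤n⇒m≤1+n (count-+ n i)

  count-all : ∀ n i → (∀ s → n ≤ s → s ℕ.< n + i → P s) → count (n + i) ≡ count n + i
  count-all n zero    all = trans (cong count (ℕ.+-identityʳ n)) (sym (ℕ.+-identityʳ _))
  count-all n (suc i) all rewrite ℕ.+-suc n i | ℕ.+-suc (count n) i =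
    trans (count-yes (all (n + i) (ℕ.m≤m+n n i) ℕ.≤-refl))
      (cong suc (count-all n i (λ s n≤s s< → all s n≤s (ℕ.m≤n⇒m≤1+n s<))))

  count-none : ∀ n i → (∀ s → n ≤ s → ¬ P s) → count (n + i) ≡ count n
  count-none n zero    none = cong count (ℕ.+-identityʳ n)
  count-none n (suc i) none rewrite ℕ.+-suc n i =
    trans (count-no (none (n + i) (ℕ.m≤m+n n i))) (count-none n i none)

  -- A discrete intermediate value argument: as c decreases from n, the value count c + (n − c)
  -- grows by one at each c outside P and is constant elsewhere.
  select : ∀ n {q} → count n ≤ q → q ℕ.< n →
    ∃ λ c → ∃ λ e → c + suc e ≡ n × ¬ P c × count c + e ≡ q
  select (suc n) {q} lo hi with P? n
  select (suc n) {suc q} (s≤s lo) (s≤s hi) | yes _ =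
    let c , e , c+e , ¬P , eq = select n lo hi
    in c , suc e , trans (ℕ.+-suc c (suc e)) (cong suc c+e) , ¬P , trans (ℕ.+-suc (count c) e) (cong suc eq)
  select (suc n) {q} lo hi | no ¬Pn with ℕ.m≤n⇒m<n∨m≡n lo
  ... | inj₂ eq = n , 0 , ℕ.+-comm n 1 , ¬Pn , trans (ℕ.+-identityʳ _) eq
  select (suc n) {suc q} lo (s≤s hi) | no ¬Pn | inj₁ (s≤s lo′) =
    let c , e , c+e , ¬P , eq = select n lo′ hi
    in c , suc e , trans (ℕ.+-suc c (suc e)) (cong suc c+e) , ¬P , trans (ℕ.+-suc (count c) e) (cong suc eq)

  private
    increasing : ∀ {c c′ e e′} → ¬ P c → c ℕ.< c′ → c + e ≡ c′ + e′ → count c + e ≡ count c′ + e′ → ⊥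
    increasing {c} {c′} {e} {e′} ¬P c<c′ sum counts with i , refl ← ℕ.m≤n⇒∃[o]m+o≡n c<c′ =
      ℕ.<-irrefl (sym counts) (begin-strict
        count (suc c + i) + e′    ≤⟨ ℕ.+-monoˡ-≤ e′ (count-+ (suc c) i) ⟩
        count (suc c) + i + e′    ≡⟨ cong (λ x → x + i + e′) (count-no ¬P) ⟩
        count c + i + e′          ≡⟨ ℕ.+-assoc (count c) i e′ ⟩
        count c + (i + e′)        <⟨ ℕ.+-monoʳ-< (count c) (ℕ.≤-reflexive (sym e≡)) ⟩
        count c + e               ∎)
      where
      open ℕ.≤-Reasoning
      e≡ : e ≡ suc (i + e′)
      e≡ = ℕ.+-cancelˡ-≡ c e (suc (i + e′)) (trans sum (trans (cong suc (ℕ.+-assoc c i e′)) (sym (ℕ.+-suc c (i + e′)))))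

  select-unique : ∀ {c c′ e e′} → ¬ P c → ¬ P c′ → c + e ≡ c′ + e′ → count c + e ≡ count c′ + e′ → c ≡ c′
  select-unique {c} {c′} ¬P ¬P′ sum counts with ℕ.<-cmp c c′
  ... | tri≈ _ eq _ = eq
  ... | tri< c<c′ _ _ = ⊥-elim (increasing ¬P c<c′ sum counts)
  ... | tri> _ _ c′<c = ⊥-elim (increasing ¬P′ c′<c (sym sum) (sym counts))

count-cong : ∀ {P Q : ℕ → Set} (P? : Decidable P) (Q? : Decidable Q) n →
  (∀ s → s ℕ.< n → P s ⇔ Q s) → count P? n ≡ count Q? n
count-cong P? Q? zero    _ = refl
count-cong P? Q? (suc n) P⇔Q with P? n
... | yes Pn = trans (cong suc (count-cong P? Q? n (λ s s<n → P⇔Q s (ℕ.m≤n⇒m≤1+n s<n)))) (sym (count-yes Q? (to (P⇔Q n ℕ.≤-refl) Pn)))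
... | no ¬Pn = trans (count-cong P? Q? n (λ s s<n → P⇔Q s (ℕ.m≤n⇒m≤1+n s<n))) (sym (count-no Q? (¬Pn ∘ from (P⇔Q n ℕ.≤-refl))))

killedSites : Code m → ℕ
killedSites {m} c = count (killed? c) (suc m)

module _ (d : Fin (1 + m)) (u : Code m) (p≤d : descentThreshold u ≤ toℕ d) where

  private
    alive-above : ∀ s → toℕ d ≤ s → ¬ Killed u s
    alive-above s d≤s k = ℕ.<⇒≱ (killed⇒<descentBottoms u k) (ℕ.≤-trans (ℕ.m⊔n≤o⇒m≤o _ _ p≤d) d≤s)

  killedSites-below : killedSites u ≡ count (killed? u) (suc (toℕ d))
  killedSites-below with i , eq ← ℕ.m≤n⇒∃[o]m+o≡n (s≤s⁻¹ (toℕ<n d)) = begin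
    count (killed? u) (suc m)               ≡⟨ cong (count (killed? u) ∘ suc) eq ⟨
    count (killed? u) (suc (toℕ d) + i)     ≡⟨ count-none (killed? u) (suc (toℕ d)) i (λ s d<s → alive-above s (ℕ.<⇒≤ d<s)) ⟩
    count (killed? u) (suc (toℕ d))         ∎
    where open ≡-Reasoning

  killedSites-strictlyBelow : killedSites u ≡ count (killed? u) (toℕ d)
  killedSites-strictlyBelow =
    trans killedSites-below (count-no (killed? u) (alive-above (toℕ d) ℕ.≤-refl))

  module _ (c : Fin (2 + m)) (alive : ¬ Killed u (toℕ c)) (c≤d : toℕ c ≤ toℕ d) where

    private
      descentBottoms-d : descentBottoms (d ∷ u) ≡ toℕ d
      descentBottoms-d =
        trans (cong (toℕ d ⊔_) (shift-≤ (toℕ d) _ r≤d)) (ℕ.m≥n⇒m⊔n≡m r≤d)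
        where r≤d = ℕ.m⊔n≤o⇒m≤o _ _ p≤d

      killed-low : ∀ s → s ≤ toℕ c → Killed (c ∷ d ∷ u) s ⇔ Killed u s
      killed-low s s≤c = mk⇔
        [ (λ (c<s , _) → ⊥-elim (ℕ.<⇒≱ c<s s≤c)) ,
          [ (λ (d<s , _) → ⊥-elim (ℕ.<⇒≱ d<s (subst (_≤ toℕ d) (sym pin-c) s≤d))) , subst (Killed u) pins ]′ ]′
        (λ k → inj₂ (inj₂ (subst (Killed u) (sym pins) k)))
        where
        s≤d : s ≤ toℕ d
        s≤d = ℕ.≤-trans s≤c c≤d
        pin-c : pin (toℕ c) s ≡ s
        pin-c = pin-≤ (toℕ c) s s≤c
        pins : pin (toℕ d) (pin (toℕ c) s) ≡ s
        pins = trans (cong (pin (toℕ d)) pin-c) (pin-≤ (toℕ d) s s≤d)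

      killed-middle : ∀ s → toℕ c ℕ.< s → s ≤ toℕ d → Killed (c ∷ d ∷ u) s
      killed-middle s c<s s≤d = inj₁ (c<s , subst (s ≤_) (sym descentBottoms-d) s≤d)

      alive-high : ∀ s → toℕ d ℕ.< s → ¬ Killed (c ∷ d ∷ u) s
      alive-high (suc s) d<s (inj₁ (_ , s≤d)) = ℕ.<⇒≱ d<s (subst (suc s ≤_) descentBottoms-d s≤d)
      alive-high (suc s) (s≤s d≤s) (inj₂ k) rewrite pin-> (toℕ c) s (ℕ.≤-trans c≤d d≤s) with k
      ... | inj₁ (d<s , s≤r) = ℕ.<⇒≱ d<s (ℕ.≤-trans s≤r (ℕ.m⊔n≤o⇒m≤o _ _ p≤d))
      ... | inj₂ k′ = alive-above _ (d≤pin s d≤s) k′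
        where
        d≤pin : ∀ s → toℕ d ≤ s → toℕ d ≤ pin (toℕ d) s
        d≤pin s d≤s with ℕ.m≤n⇒m<n∨m≡n d≤s
        ... | inj₁ (s≤s {n = t} d≤t) = subst (toℕ d ≤_) (sym (pin-> (toℕ d) t d≤t)) d≤t
        ... | inj₂ refl = ℕ.≤-reflexive (sym (pin-≤ (toℕ d) (toℕ d) ℕ.≤-refl))

    -- For c < d, inserting c shifts the bound d of the descent bottoms to d + 1. For c = d the
    -- bound stays d, and d + 1 comes from the first letter.
    descentThreshold-step : descentThreshold (c ∷ d ∷ u) ≡ suc (toℕ d)
    descentThreshold-step rewrite descentBottoms-d with ℕ.m≤n⇒m<n∨m≡n c≤d
    ... | inj₁ c<d rewrite shift-> (toℕ c) (toℕ d) c<d =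
      trans (cong (_⊔ suc (toℕ c)) (ℕ.m≤n⇒m⊔n≡n (ℕ.m≤n⇒m≤1+n c≤d))) (ℕ.m≥n⇒m⊔n≡m (s≤s c≤d))
    ... | inj₂ c≡d rewrite shift-≤ (toℕ c) (toℕ d) (ℕ.≤-reflexive (sym c≡d)) =
      trans (cong (_⊔ suc (toℕ c)) (ℕ.m≤n⇒m⊔n≡n c≤d))
        (trans (ℕ.m≤n⇒m⊔n≡n (ℕ.m≤n⇒m≤1+n (ℕ.≤-reflexive (sym c≡d)))) (cong suc c≡d))

    -- Sites below c keep their status and c stays alive; the `e` sites from c + 1 to d are killed,
    -- with c as the 1 and a descent from d as the 43; sites above d exceed every descent bottom.
    killedSites-step : ∀ e → toℕ c + e ≡ toℕ d → killedSites (c ∷ d ∷ u) ≡ count (killed? u) (toℕ c) + e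
    killedSites-step e c+e with i , eq ← ℕ.m≤n⇒∃[o]m+o≡n (ℕ.m≤n⇒m≤1+n (ℕ.m≤n⇒m≤1+n (s≤s⁻¹ (toℕ<n d)))) = begin
      count K? (3 + m)                    ≡⟨ cong (count K? ∘ suc) (trans (cong (_+ i) c+e) eq) ⟨
      count K? (suc (toℕ c) + e + i)
        ≡⟨ count-none K? (suc (toℕ c) + e) i (λ s lt → alive-high s (subst (λ x → suc x ≤ s) c+e lt)) ⟩
      count K? (suc (toℕ c) + e)
        ≡⟨ count-all K? (suc (toℕ c)) e (λ s lt le → killed-middle s lt (subst (s ≤_) c+e (s≤s⁻¹ le))) ⟩
      count K? (suc (toℕ c)) + e
        ≡⟨ cong (_+ e) (count-no K? (alive ∘ to (killed-low (toℕ c) ℕ.≤-refl))) ⟩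
      count K? (toℕ c) + e
        ≡⟨ cong (_+ e) (count-cong K? (killed? u) (toℕ c) (λ s s<c → killed-low s (ℕ.<⇒≤ s<c))) ⟩
      count (killed? u) (toℕ c) + e       ∎
      where
      open ≡-Reasoning
      K? = killed? (c ∷ d ∷ u)

tree-2143 : GeneratingTree (λ n → Code (n * 2)) (λ {n} → Valid-2143 n)
tree-2143 = record
  { valid?       = valid-2143? _
  ; p            = descentThreshold
  ; q            = killedSites
  ; root         = []
  ; root-valid   = tt
  ; root-unique  = λ { [] → refl }
  ; root-p       = refl
  ; root-q       = refl
  ; parent       = drop₂
  ; parent-valid = λ { {c = _ ∷ _ ∷ _} (v , _) → v }
  ; p-increases  = λ {_} {c} v → proj₁ (bounds c v)
  ; p-bounded    = λ {_} {c} v → proj₁ (proj₂ (bounds c v))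
  ; q-monotone   = λ {_} {c} v → proj₁ (proj₂ (proj₂ (bounds c v)))
  ; q<p          = λ {_} {c} v → proj₂ (proj₂ (proj₂ (bounds c v)))
  ; label-unique = λ {_} {c} {c′} → unique c c′
  ; child        = child
  }
  where
  bounds : ∀ {n} (c : Code (2 + n * 2)) → Valid-2143 (suc n) c →
    descentThreshold (drop₂ c) ℕ.< descentThreshold c × descentThreshold c ≤ suc (n * 2) ×
    killedSites (drop₂ c) ≤ killedSites c × killedSites c ℕ.< descentThreshold c
  bounds (c ∷ d ∷ u) (_ , p≤d , alive , c≤d)
    with e , c+e ← ℕ.m≤n⇒∃[o]m+o≡n c≤d
    rewrite descentThreshold-step d u p≤d c alive c≤d
          | killedSites-step d u p≤d c alive c≤d e c+e
          | killedSites-strictlyBelow d u p≤d =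
    s≤s p≤d , toℕ<n d ,
    subst (λ x → count (killed? u) x ≤ count (killed? u) (toℕ c) + e) c+e (count-+ (killed? u) (toℕ c) e) ,
    s≤s (subst (count (killed? u) (toℕ c) + e ≤_) c+e (ℕ.+-monoˡ-≤ e (count-+ (killed? u) 0 (toℕ c))))

  unique : ∀ {n} (c c′ : Code (2 + n * 2)) → Valid-2143 (suc n) c → Valid-2143 (suc n) c′ →
    drop₂ c ≡ drop₂ c′ → descentThreshold c ≡ descentThreshold c′ → killedSites c ≡ killedSites c′ → c ≡ c′
  unique (c ∷ d ∷ u) (c′ ∷ d′ ∷ u) (_ , p≤d , alive , c≤d) (_ , p≤d′ , alive′ , c≤d′) refl p≡ q≡
    with refl ← toℕ-injective (ℕ.suc-injective (trans (sym (descentThreshold-step d u p≤d c alive c≤d))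
                  (trans p≡ (descentThreshold-step d′ u p≤d′ c′ alive′ c≤d′))))
    with e , c+e ← ℕ.m≤n⇒∃[o]m+o≡n c≤d | e′ , c′+e′ ← ℕ.m≤n⇒∃[o]m+o≡n c≤d′ =
    cong (λ c → c ∷ d ∷ u) (toℕ-injective (select-unique (killed? u) alive alive′
      (trans c+e (sym c′+e′))
      (trans (sym (killedSites-step d u p≤d c alive c≤d e c+e))
        (trans q≡ (killedSites-step d u p≤d c′ alive′ c≤d′ e′ c′+e′)))))

  child : ∀ {n} {u : Code (n * 2)} {p′ q′} → Valid-2143 n u →
    descentThreshold u ℕ.< p′ → p′ ≤ suc (n * 2) → killedSites u ≤ q′ → q′ ℕ.< p′ →
    ∃ λ c → Valid-2143 (suc n) c × drop₂ c ≡ u × descentThreshold c ≡ p′ × killedSites c ≡ q′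
  child {u = u} {q′ = q′} v (s≤s p≤d) (s≤s d≤m) q≤q′ q′<p′
    with d , refl ← letter (s≤s d≤m)
    -- The length d + 1 lets the choice of c run up to d inclusive.
    with c₀ , e , c+e , alive , count≡ ← select (killed? u) (suc (toℕ d))
           (subst (_≤ q′) (killedSites-below d u p≤d) q≤q′) q′<p′
    with c+e′ ← ℕ.suc-injective (trans (sym (ℕ.+-suc c₀ e)) c+e)
    with c≤d ← ℕ.m+n≤o⇒m≤o c₀ (ℕ.≤-reflexive c+e′)
    with c , refl ← letter (s≤s (ℕ.m≤n⇒m≤1+n (ℕ.≤-trans c≤d d≤m))) =
    c ∷ d ∷ u , (v , p≤d , alive , c≤d) , refl ,
    descentThreshold-step d u p≤d c alive c≤d ,
    trans (killedSites-step d u p≤d c alive c≤d e c+e′) count≡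

size-2143 : ∀ n → HasSize (A (n * 2) [2143]) (skew 0 0 0 n)
size-2143 n = permutation-size
  (λ c → ⇔.trans (valid-2143⇔ n c) (alternating⇔upDownCode n c ×-⇔
    ¬-cong-⇔ (⇔.sym (⇔.trans (contains⇔Subsequence (Inverse.to code↔permutation c) [2143]) (Subsequence-cong 4 iso-2143 (word c))))))
  (GeneratingTree.size tree-2143 n)

-- Standard Young tableaux

LeftOf : ∀ n → Fin k → Fin k → Fin k → Vec (Fin k) (n * 3) → Set
LeftOf zero    a b c []              = ⊤
LeftOf (suc n) a b c (x ∷ y ∷ z ∷ _) = a < x × b < y × c < z

-- Words are column readings T(1,1) T(2,1) T(3,1) T(1,2) ….
Standard : ∀ n → Vec (Fin k) (n * 3) → Set
Standard zero    []              = ⊤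
Standard (suc n) (a ∷ b ∷ c ∷ w) = ((a < b × b < c) × LeftOf n a b c w) × Standard n w

leftOf-punchIn : ∀ n (v : Fin (suc k)) a b c (w : Vec (Fin k) (n * 3)) →
  LeftOf n (punchIn v a) (punchIn v b) (punchIn v c) (map (punchIn v) w) ⇔ LeftOf n a b c w
leftOf-punchIn zero    v a b c []              = ⇔.refl
leftOf-punchIn (suc n) v a b c (x ∷ y ∷ z ∷ _) =
  punchIn-<⇔ v a x ×-⇔ punchIn-<⇔ v b y ×-⇔ punchIn-<⇔ v c z

standard-punchIn : ∀ n (v : Fin (suc k)) (w : Vec (Fin k) (n * 3)) →
  Standard n (map (punchIn v) w) ⇔ Standard n w
standard-punchIn zero    v []              = ⇔.refl
standard-punchIn (suc n) v (a ∷ b ∷ c ∷ w) =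
  ((punchIn-<⇔ v a b ×-⇔ punchIn-<⇔ v b c) ×-⇔ leftOf-punchIn n v a b c w) ×-⇔ standard-punchIn n v w

-- For valid codes, the numbers of letters smaller than the second and the third letter.
second third : ∀ n → Code (n * 3) → ℕ
second zero    []              = 0
second (suc n) (_ ∷ e ∷ _ ∷ _) = suc (toℕ e)
third  zero    []              = 0
third  (suc n) (_ ∷ _ ∷ f ∷ _) = 2 + toℕ f

-- Since T(2,1) < T(3,1), both `e` and `f` count letters of `u` alone. They are compared with the
-- ranks in `u` of the right neighbours T(2,2) and T(3,2).
Valid-SYT : ∀ n → Code (n * 3) → Set
Valid-SYT zero    []              = ⊤
Valid-SYT (suc n) (d ∷ e ∷ f ∷ u) =
  Valid-SYT n u × d ≡ zero × toℕ e ≤ second n u × toℕ e ≤ toℕ f × toℕ f ≤ third n u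

valid-SYT? : ∀ n (c : Code (n * 3)) → Dec (Valid-SYT n c)
valid-SYT? zero    []              = yes tt
valid-SYT? (suc n) (d ∷ e ∷ f ∷ u) = valid-SYT? n u ×-dec d ≟ zero ×-dec
  toℕ e ℕ.≤? second n u ×-dec toℕ e ℕ.≤? toℕ f ×-dec toℕ f ℕ.≤? third n u

toℕ-punchIn-≥ : ∀ (v : Fin (suc m)) x → toℕ v ≤ toℕ x → toℕ (punchIn v x) ≡ suc (toℕ x)
toℕ-punchIn-≥ zero    x       _         = refl
toℕ-punchIn-≥ (suc v) (suc x) (s≤s v≤x) = cong suc (toℕ-punchIn-≥ v x v≤x)

punchIn-zero : ∀ (v : Fin (2 + m)) {s} → s ≤ toℕ v → s ≤ toℕ (punchIn v zero) → s ≤ 0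
punchIn-zero zero    s≤v _ = s≤v
punchIn-zero (suc v) _ s≤  = s≤

≤-punchIn-≥ : ∀ (v : Fin (suc m)) x {s} → s ≤ toℕ v → s ≤ toℕ (punchIn v x) ⇔ s ≤ toℕ x
≤-punchIn-≥ v x {s} s≤v = subst (λ t → s ≤ toℕ (punchIn v x) ⇔ t ≤ toℕ x) (pin-≤ (toℕ v) s s≤v) (≤-punchIn v s x)

-- Validity of `u` makes T(1,2) its least letter, which forces `d` to be zero, and puts exactly
-- `2 + z` letters of `u` below T(3,2).
column-insertion : ∀ n (d : Fin (3 + n * 3)) (e : Fin (2 + n * 3)) (f : Fin (1 + n * 3)) u → Valid-SYT n u →
  ((d < punchIn d e × punchIn d e < punchIn d (punchIn e f)) ×
    LeftOf n d (punchIn d e) (punchIn d (punchIn e f)) (map (punchIn d) (map (punchIn e) (map (punchIn f) (word u)))))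
  ⇔ (d ≡ zero × toℕ e ≤ second n u × toℕ e ≤ toℕ f × toℕ f ≤ third n u)
column-insertion zero d e f [] _ = mk⇔
  (λ ((d<e , e<f) , _) →
    let d≤e = to (<-punchIn-self d e) d<e
        e≤f = to (<-punchIn-self e f) (to (punchIn-<⇔ d e (punchIn e f)) e<f)
        f≤0 = s≤s⁻¹ (toℕ<n f)
    in toℕ-injective (ℕ.n≤0⇒n≡0 (ℕ.≤-trans d≤e (ℕ.≤-trans e≤f f≤0))) , ℕ.≤-trans e≤f f≤0 , e≤f , f≤0)
  (λ { (refl , _ , e≤f , _) → (s≤s z≤n , from (punchIn-<⇔ zero e (punchIn e f)) (from (<-punchIn-self e f) e≤f)) , tt })
column-insertion (suc n) d e f (x ∷ y ∷ z ∷ u) (_ , refl , _ , y≤z , _) = mk⇔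
  (λ ((d<e , e<f) , x< , y< , z<) →
    let d≤e = to (<-punchIn-self d e) d<e
        e≤f = to (<-punchIn-self e f) (to (punchIn-<⇔ d e (punchIn e f)) e<f)
        d≤  = to (≤-punchIn-≥ e (punchIn f zero) d≤e) (to (<-punchIn-self d (punchIn e (punchIn f zero))) x<)
    in toℕ-injective (ℕ.n≤0⇒n≡0 (punchIn-zero f (ℕ.≤-trans d≤e e≤f) d≤)) ,
       to (≤-punchIn-≥ f Y e≤f) (to (<-punchIn-self e (punchIn f Y)) (to (punchIn-<⇔ d e _) y<)) ,
       e≤f ,
       subst (toℕ f ≤_) Z≡ (to (<-punchIn-self f Z) (to (punchIn-<⇔ e f _) (to (punchIn-<⇔ d _ _) z<))))
  (λ { (refl , e≤y , e≤f , f≤z) →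
    (s≤s z≤n , from (punchIn-<⇔ zero e (punchIn e f)) (from (<-punchIn-self e f) e≤f)) ,
    s≤s z≤n ,
    from (punchIn-<⇔ zero e _) (from (<-punchIn-self e (punchIn f Y)) (from (≤-punchIn-≥ f Y e≤f) e≤y)) ,
    from (punchIn-<⇔ zero (punchIn e f) _) (from (punchIn-<⇔ e f _) (from (<-punchIn-self f Z) (subst (toℕ f ≤_) (sym Z≡) f≤z))) })
  where
  Y Z : Fin (3 + n * 3)
  Y = suc y
  Z = suc (punchIn y z)
  Z≡ : toℕ Z ≡ 2 + toℕ z
  Z≡ = cong suc (toℕ-punchIn-≥ y z y≤z)

standard⇔valid-SYT : ∀ n (c : Code (n * 3)) → Standard n (word c) ⇔ Valid-SYT n c
standard⇔valid-SYT zero    []              = ⇔.refl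
standard⇔valid-SYT (suc n) (d ∷ e ∷ f ∷ u) = mk⇔
  (λ (column , std) → let v = to rest std in v , to (column-insertion n d e f u v) column)
  (λ (v , column) → from (column-insertion n d e f u v) column , from rest v)
  where
  rest : Standard n (map (punchIn d) (map (punchIn e) (map (punchIn f) (word u)))) ⇔ Valid-SYT n u
  rest = ⇔.trans (standard-punchIn n d _) (⇔.trans (standard-punchIn n e _)
    (⇔.trans (standard-punchIn n f _) (standard⇔valid-SYT n u)))

-- Only entries of the first two rows can be smaller than T(3,1). Hence no subtraction in the labels
-- is truncated.
third≤ : ∀ n (c : Code (n * 3)) → Valid-SYT n c → third n c ≤ n * 2
third≤ zero    []              _ = z≤n
third≤ (suc n) (d ∷ e ∷ f ∷ u) (v , _ , _ , _ , f≤) = s≤s (s≤s (ℕ.≤-trans f≤ (third≤ n u v)))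

drop₃ : Code (3 + m) → Code m
drop₃ (_ ∷ _ ∷ _ ∷ u) = u

tree-SYT : GeneratingTree (λ n → Code (n * 3)) (λ {n} → Valid-SYT n)
tree-SYT = record
  { valid?       = valid-SYT? _
  ; p            = λ {n} c → n * 2 ∸ second n c
  ; q            = λ {n} c → n * 2 ∸ third n c
  ; root         = []
  ; root-valid   = tt
  ; root-unique  = λ { [] → refl }
  ; root-p       = refl
  ; root-q       = refl
  ; parent       = drop₃
  ; parent-valid = λ { {c = _ ∷ _ ∷ _ ∷ _} (v , _) → v }
  ; p-increases  = λ { {n} {d ∷ e ∷ f ∷ u} (v , _ , e≤ , e≤f , f≤) →
      ℕ.≤-trans (s≤s (ℕ.∸-monoʳ-≤ (n * 2) e≤))
        (ℕ.≤-reflexive (sym (ℕ.+-∸-assoc 1 (ℕ.≤-trans e≤f (ℕ.≤-trans f≤ (third≤ n u v)))))) }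
  ; p-bounded    = λ { {n} {d ∷ e ∷ f ∷ u} _ → ℕ.m∸n≤m (suc (n * 2)) (toℕ e) }
  ; q-monotone   = λ { {n} {d ∷ e ∷ f ∷ u} (_ , _ , _ , _ , f≤) → ℕ.∸-monoʳ-≤ (n * 2) f≤ }
  ; q<p          = λ { {n} {d ∷ e ∷ f ∷ u} (v , _ , e≤ , e≤f , f≤) →
      ℕ.≤-trans (s≤s (ℕ.∸-monoʳ-≤ (n * 2) e≤f))
        (ℕ.≤-reflexive (sym (ℕ.+-∸-assoc 1 (ℕ.≤-trans e≤f (ℕ.≤-trans f≤ (third≤ n u v)))))) }
  ; label-unique = λ {_} {c} {c′} → unique c c′
  ; child        = child
  }
  where
  unique : ∀ {n} (c c′ : Code (3 + n * 3)) → Valid-SYT (suc n) c → Valid-SYT (suc n) c′ → drop₃ c ≡ drop₃ c′ →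
    2 + n * 2 ∸ second (suc n) c ≡ 2 + n * 2 ∸ second (suc n) c′ →
    2 + n * 2 ∸ third (suc n) c ≡ 2 + n * 2 ∸ third (suc n) c′ → c ≡ c′
  unique {n} (d ∷ e ∷ f ∷ u) (d′ ∷ e′ ∷ f′ ∷ u) (v , refl , _ , e≤f , f≤) (_ , refl , _ , e≤f′ , f≤′) refl p≡ q≡ =
    cong₂ (λ e f → zero ∷ e ∷ f ∷ u)
      (toℕ-injective (ℕ.∸-cancelˡ-≡ (ℕ.m≤n⇒m≤1+n (ℕ.≤-trans e≤f f≤2n)) (ℕ.m≤n⇒m≤1+n (ℕ.≤-trans e≤f′ f≤2n′)) p≡))
      (toℕ-injective (ℕ.∸-cancelˡ-≡ f≤2n f≤2n′ q≡))
    where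
    f≤2n : toℕ f ≤ n * 2
    f≤2n = ℕ.≤-trans f≤ (third≤ n u v)
    f≤2n′ : toℕ f′ ≤ n * 2
    f≤2n′ = ℕ.≤-trans f≤′ (third≤ n u v)

  child : ∀ {n} {u : Code (n * 3)} {p′ q′} → Valid-SYT n u →
    n * 2 ∸ second n u ℕ.< p′ → p′ ≤ suc (n * 2) → n * 2 ∸ third n u ≤ q′ → q′ ℕ.< p′ →
    ∃ λ c → Valid-SYT (suc n) c × drop₃ c ≡ u ×
      2 + n * 2 ∸ second (suc n) c ≡ p′ × 2 + n * 2 ∸ third (suc n) c ≡ q′
  child {n} {u} {suc p′} {q′} v (s≤s p≤p′) (s≤s p′≤) q≤q′ (s≤s q′≤p′) =
    -- The solutions of `suc (n * 2) ∸ e = suc p′` and `n * 2 ∸ f = q′`.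
    let e , e≡ = letter {2 + n * 3} (ℕ.m≤n⇒m≤1+n (s≤s (bound p′)))
        f , f≡ = letter {1 + n * 3} (s≤s (bound q′))
    in zero ∷ e ∷ f ∷ u ,
       (v , refl ,
        subst (_≤ second n u) (sym e≡) (flip p≤p′) ,
        subst₂ _≤_ (sym e≡) (sym f≡) (ℕ.∸-monoʳ-≤ (n * 2) q′≤p′) ,
        subst (_≤ third n u) (sym f≡) (flip q≤q′)) ,
       refl ,
       trans (cong (suc (n * 2) ∸_) e≡)
         (trans (ℕ.+-∸-assoc 1 (ℕ.m∸n≤m (n * 2) p′)) (cong suc (ℕ.m∸[m∸n]≡n p′≤))) ,
       trans (cong (n * 2 ∸_) f≡) (ℕ.m∸[m∸n]≡n (ℕ.≤-trans q′≤p′ p′≤))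
    where
    bound : ∀ x → n * 2 ∸ x ≤ n * 3
    bound x = ℕ.≤-trans (ℕ.m∸n≤m (n * 2) x) (ℕ.*-monoʳ-≤ n (ℕ.n≤1+n 2))
    flip : ∀ {x y} → n * 2 ∸ x ≤ y → n * 2 ∸ y ≤ x
    flip {x} {y} le = ℕ.m≤n+o⇒m∸n≤o (n * 2) y
      (ℕ.≤-trans (ℕ.m≤n+m∸n (n * 2) x) (ℕ.≤-trans (ℕ.+-monoʳ-≤ x le) (ℕ.≤-reflexive (ℕ.+-comm x y))))

-- Fillings and their column readings

Cells : (Fin 3 → Fin n → Fin k) → Set
Cells f = (∀ r c c′ → c < c′ → f r c < f r c′) × (∀ r r′ c → r < r′ → f r c < f r′ c)

cells-cong : ∀ {f g : Fin 3 → Fin n → Fin k} → (∀ r c → f r c ≡ g r c) → Cells f → Cells g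
cells-cong f≡g (rows , columns) =
  (λ r c c′ lt → subst₂ _<_ (f≡g r c) (f≡g r c′) (rows r c c′ lt)) ,
  (λ r r′ c lt → subst₂ _<_ (f≡g r c) (f≡g r′ c) (columns r r′ c lt))

cell-of : ∀ {A : Set} → Vec A (n * 3) → Fin 3 → Fin n → A
cell-of w r c = lookup w (combine c r)

cells⇒standard : ∀ n (w : Vec (Fin k) (n * 3)) → Cells {n = n} (cell-of w) → Standard n w
cells⇒standard zero    []              _                = tt
cells⇒standard (suc n) (a ∷ b ∷ c ∷ w) (rows , columns) =
  ((columns 0F 1F zero (s≤s z≤n) , columns 1F 2F zero (s≤s (s≤s z≤n))) , leftOf n w rows) ,
  cells⇒standard n w ((λ r c c′ lt → rows r (suc c) (suc c′) (s≤s lt)) , (λ r r′ c → columns r r′ (suc c)))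
  where
  leftOf : ∀ n (w : Vec (Fin _) (n * 3)) →
    (∀ r (i i′ : Fin (suc n)) → i < i′ → cell-of {suc n} (a ∷ b ∷ c ∷ w) r i < cell-of {suc n} (a ∷ b ∷ c ∷ w) r i′) →
    LeftOf n a b c w
  leftOf zero    []              rows = tt
  leftOf (suc n) (x ∷ y ∷ z ∷ w) rows = rows 0F 0F 1F (s≤s z≤n) , rows 1F 0F 1F (s≤s z≤n) , rows 2F 0F 1F (s≤s z≤n)

standard⇒cells : ∀ n (w : Vec (Fin k) (n * 3)) → Standard n w → Cells {n = n} (cell-of w)
standard⇒cells zero    []              _   = (λ _ ()) , (λ _ _ ())
standard⇒cells {k} (suc n) (a ∷ b ∷ c ∷ w) (((a<b , b<c) , left) , std) = rows , columns
  where
  IH : Cells {n = n} (cell-of w)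
  IH = standard⇒cells n w std
  leftOf-first : ∀ n (w : Vec (Fin k) (suc n * 3)) → LeftOf (suc n) a b c w →
    ∀ r → lookup (a ∷ b ∷ c ∷ []) r < cell-of {suc n} w r zero
  leftOf-first n (x ∷ y ∷ z ∷ w) (a<x , b<y , c<z) 0F = a<x
  leftOf-first n (x ∷ y ∷ z ∷ w) (a<x , b<y , c<z) 1F = b<y
  leftOf-first n (x ∷ y ∷ z ∷ w) (a<x , b<y , c<z) 2F = c<z
  leftOf : ∀ n (w : Vec (Fin k) (n * 3)) → Cells {n = n} (cell-of w) → LeftOf n a b c w →
    ∀ r (i : Fin n) → lookup (a ∷ b ∷ c ∷ []) r < cell-of w r i
  leftOf (suc n) w cells left r zero    = leftOf-first n w left r
  leftOf (suc n) w cells left r (suc i) = ℕ.<-trans (leftOf-first n w left r) (proj₁ cells r zero (suc i) (s≤s z≤n))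
  first-column : ∀ r → cell-of {suc n} (a ∷ b ∷ c ∷ w) r zero ≡ lookup (a ∷ b ∷ c ∷ []) r
  first-column 0F = refl
  first-column 1F = refl
  first-column 2F = refl
  rows : ∀ r (i i′ : Fin (suc n)) → i < i′ → cell-of {suc n} (a ∷ b ∷ c ∷ w) r i < cell-of {suc n} (a ∷ b ∷ c ∷ w) r i′
  rows r zero    (suc i′) _        = subst (_< cell-of w r i′) (sym (first-column r)) (leftOf n w IH left r i′)
  rows r (suc i) (suc i′) (s≤s lt) = proj₁ IH r i i′ lt
  columns : ∀ r r′ (i : Fin (suc n)) → r < r′ → cell-of {suc n} (a ∷ b ∷ c ∷ w) r i < cell-of {suc n} (a ∷ b ∷ c ∷ w) r′ i
  columns 0F 1F zero _ = a<b
  columns 0F 2F zero _ = ℕ.<-trans a<b b<c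
  columns 1F 1F zero (s≤s ())
  columns 1F 2F zero _ = b<c
  columns 2F 1F zero (s≤s ())
  columns 2F 2F zero (s≤s (s≤s ()))
  columns r r′ (suc i) lt = proj₂ IH r r′ i lt

columnReading : ∀ {A : Set} → Vec (Vec A n) 3 → Vec A (n * 3)
columnReading {n} T = tabulate λ i → let c , r = remQuot {n} 3 i in lookup (lookup T r) c

rowsOf : ∀ {A : Set} → Vec A (n * 3) → Vec (Vec A n) 3
rowsOf w = tabulate λ r → tabulate (cell-of w r)

lookup-columnReading : ∀ {A : Set} (T : Vec (Vec A n) 3) r c → cell-of (columnReading T) r c ≡ lookup (lookup T r) c
lookup-columnReading T r c = trans (Vec.lookup∘tabulate _ (combine c r))
  (cong (λ (c , r) → lookup (lookup T r) c) (remQuot-combine c r))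

rowsOf-columnReading : ∀ {A : Set} (T : Vec (Vec A n) 3) → rowsOf (columnReading T) ≡ T
rowsOf-columnReading T = trans
  (Vec.tabulate-cong λ r → trans (Vec.tabulate-cong (lookup-columnReading T r)) (Vec.tabulate∘lookup (lookup T r)))
  (Vec.tabulate∘lookup T)

columnReading-rowsOf : ∀ {A : Set} (w : Vec A (n * 3)) → columnReading {n} (rowsOf w) ≡ w
columnReading-rowsOf {n} w = trans
  (Vec.tabulate-cong λ i → let c , r = remQuot {n} 3 i in
    trans (cong (λ row → lookup row c) (Vec.lookup∘tabulate (λ r → tabulate (cell-of w r)) r))
      (trans (Vec.lookup∘tabulate (cell-of w r) c) (cong (lookup w) (combine-remQuot {n} 3 i))))
  (Vec.tabulate∘lookup w)

-- The alphabet size `k` is kept free so that the count can be transported from `n * 3` to `3 * n`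
-- letters with the shape fixed.
EachOnce : Vec (Vec (Fin k) n) 3 → Set
EachOnce {k} {n} T = ∀ (a : Fin k) → ∃! _≡_ λ ((r , c) : Fin 3 × Fin n) → lookup (lookup T r) c ≡ a

eachOnce⇔permutation : (T : Vec (Vec (Fin (n * 3)) n) 3) → EachOnce T ⇔ IsPermutation (columnReading T)
eachOnce⇔permutation {n} T = mk⇔ once⇒perm perm⇒once
  where
  once⇒perm : EachOnce T → IsPermutation (columnReading T)
  once⇒perm once a with (r , c) , eq , unique ← once a =
    combine c r , trans (lookup-columnReading T r c) eq , λ {i} eqᵢ →
      trans (cong (λ (r , c) → combine c r)
        (unique {swap (remQuot {n} 3 i)} (trans (sym (Vec.lookup∘tabulate _ i)) eqᵢ)))
        (combine-remQuot {n} 3 i)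
  perm⇒once : IsPermutation (columnReading T) → EachOnce T
  perm⇒once perm a with i , eq , unique ← perm a =
    swap (remQuot {n} 3 i) , trans (sym (Vec.lookup∘tabulate _ i)) eq , λ {(r , c)} eq′ →
      trans (cong (swap ∘ remQuot {n} 3) (unique {combine c r} (trans (lookup-columnReading T r c) eq′)))
        (cong swap (remQuot-combine c r))

StandardFilling : Vec (Vec (Fin k) n) 3 → Set
StandardFilling T = EachOnce T × Cells (λ r c → lookup (lookup T r) c)

standardFilling⇔ : (T : Vec (Vec (Fin (n * 3)) n) 3) →
  StandardFilling T ⇔ (IsPermutation (columnReading T) × Standard n (columnReading T))
standardFilling⇔ {n} T = eachOnce⇔permutation T ×-⇔ mk⇔
  (λ cells → cells⇒standard n _ (cells-cong (λ r c → sym (lookup-columnReading T r c)) cells))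
  (λ std → cells-cong (lookup-columnReading T) (standard⇒cells n _ std))

size-standardFilling : ∀ n → HasSize [ T ∈ Vec (Vec (Fin (n * 3)) n) 3 ∣ StandardFilling T ] (skew 0 0 0 n)
size-standardFilling n = ↔-trans (mk↔ₛ′
  (λ (T , [ s ]) → (columnReading T , [ proj₁ (to (standardFilling⇔ T) s) ]) , [ proj₂ (to (standardFilling⇔ T) s) ])
  (λ ((w , [ perm ]) , [ std ]) → rowsOf w , [ from (standardFilling⇔ (rowsOf w))
    (subst (λ w → IsPermutation w × Standard n w) (sym (columnReading-rowsOf {n} w)) (perm , std)) ])
  (λ ((w , _) , _) → value-injective (value-injective (columnReading-rowsOf {n} w)))
  (λ (T , _) → value-injective (rowsOf-columnReading T)))
  (permutation-size {R = λ w → Standard n (value w)} (λ c → ⇔.sym (standard⇔valid-SYT n c))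
    (GeneratingTree.size tree-SYT n))

size-SYT : ∀ n → HasSize (SYT⟨n,n,n⟩ n) (skew 0 0 0 n)
size-SYT n = size-⇔
  (λ (once , rows , columns) → record { each-once = once ; rows-increase = rows ; columns-increase = columns })
  (λ std → let open IsStandard std in each-once , rows-increase , columns-increase)
  (subst (λ k → HasSize [ T ∈ Vec (Vec (Fin k) n) 3 ∣ StandardFilling T ] (skew 0 0 0 n))
    (ℕ.*-comm n 3) (size-standardFilling n))

theorem4p6 : ∀ (n : ℕ) → n ≥ 1 →
    ∃[ N ] HasSize (A (2 * n) [2143]) N
    × HasSize (SYT⟨n,n,n⟩ n) N
    × HasSize (A (2 * n) [1234]) N
    × (+ N) / 1 ≡ ((+ (2 * (3 * n) !)) / (n ! * (n + 1) ! * (n + 2) !)) {{denominator≢0 n}}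
theorem4p6 n _ =
  skew 0 0 0 n ,
  subst (λ m → HasSize (A m [2143]) (skew 0 0 0 n)) (ℕ.*-comm n 2) (size-2143 n) ,
  size-SYT n ,
  subst (λ m → HasSize (A m [1234]) (skew 0 0 0 n)) (ℕ.*-comm n 2) (size-1234 n) ,
  fraction (2 * (3 * n) !) (skew 0 0 0 n) (n ! * (n + 1) ! * (n + 2) !) {{denominator≢0 n}} (skew-closed n)
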